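{- $\mathcal{R}_c$-treewidth and split-matching-width are incomparable, in the following sense: (1) For all $c\in\mathbb{N}$ there is a sequence of graphs $(G_i)_{i\in\mathbb{N}}$ such that for all $i\in\mathbb{N}$, the $\mathcal{R}_c$-treewidth of $G_i$ is at least $i$, but $\mathrm{smw}(G_i)\le c+3$. (2) For all $c\ge 3$ there is a sequence of graphs $(G_i)_{i\in\mathbb{N}}$ such that for all $i\in\mathbb{N}$, $\mathrm{smw}(G_i)\ge i$, but the $\mathcal{R}_c$-treewidth of $G_i$ is $0$.
   Context: All graphs are finite, simple and undirected. $\mathcal{R}_c$ is the class of graphs of rank-width at most $c$. Two parameters are incomparable if neither dominates the other, where a parameter $\alpha$ dominates $\beta$ if on each graph class where $\beta$ is bounded, $\alpha$ is also bounded. Rank-width: for a bipartition $(U,W)$ of $V(G)$, the cut-rank $\rho_G(U)$ is the rank over $\mathrm{GF}(2)$ of the $U\times W$ submatrix of the adjacency matrix of $G$. A rank-decomposition of $G$ is a pair $(T,\mu)$ where $T$ is a tree of maximum degree 3 and $\mu$ is a bijection from $V(G)$ to the leaves of $T$; its width is the maximum over edges $e$ of $T$ of $\rho_G(\mu^{ -1}(A))$, where $(A,B)$ is the bipartition of the leaves of $T$ induced by $T-e$. The rank-width of $G$ is the minimum width of a rank-decomposition of $G$. Collapsing: for $X\subseteq V(G)$, $G\circ X$ is obtained from $G$ by deleting $X$ and adding an edge between $u,v\in V(G)\setminus X$ whenever $uv\notin E(G)$ and there is a $u$-$v$ path in $G$ with all internal vertices in $X$. $G\circ X$ is an $\mathcal{R}_c$-torso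 of $G$ if each connected component of $G[X]$ (as an induced subgraph) belongs to $\mathcal{R}_c$. The $\mathcal{R}_c$-treewidth of $G$ is the minimum treewidth of an $\mathcal{R}_c$-torso of $G$; the empty graph is regarded as having treewidth $0$. Branch-width: a branch decomposition of the vertex set of $G$ is a binary tree $T$ with $V(G)$ as leaf set. Each edge $e$ of $T$ partitions $V(G)$ into two sets $X_e$ and $V(G)\setminus X_e$, the leaves in the two components of $T-e$. A cut function is a function $\kappa$ from subsets of $V(G)$ to $\mathbb{N}$ with $\kappa(A)=\kappa(V(G)\setminus A)$ for all $A\subseteq V(G)$. The width of a branch decomposition with respect to $\kappa$ is $\max_{e\in E(T)}\kappa(X_e)$, and the branch-width of $G$ with respect to $\kappa$ is the minimum such width over all branch decompositions. Split: $A\subseteq V(G)$ is a split of $G$ if $|A|\ge2$, $|V(G)\setminus A|\ge2$, and for all $v,w\in A$ with $N(v)\cap(V(G)\setminus A)\neq\emptyset$ and $N(w)\cap(V(G)\setminus A)\ne\emptyset$ one has $N(v)\cap(V(G)\setminus A)=N(w)\cap(V(G)\setminus A)$. Split-matching-width: $\mathrm{smw}(G)$ is the branch-width of $G$ with respect to the cut function $\kappa$ given by $\kappa(A)=1$ if $A$ is a split, and otherwise $\kappa(A)$ is the maximum size of a matching in the bipartite graph $G[A,V(G)\setminus A]$ of edges between $A$ and $V(G)\setminus A$. -}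

module Defs where

open import Algebra.Bundles using (CommutativeRing)
open import Data.Bool using (Bool; if_then_else_)
open import Data.Bool.Properties using (xor-∧-commutativeRing) renaming (_≟_ to _≟ᵇ_)
open import Data.Empty using (⊥; ⊥-elim)
open import Data.Fin using (Fin; zero; suc; _≟_)
open import Data.Fin.Properties using (any?; all?; injective⇒≤)
open import Data.Fin.Subset using (Subset; inside; outside; _∈_; _⊆_; _∩_; ∁; ∣_∣; Nonempty) renaming (⊥ to ∅; ⊤ to full)
open import Data.Fin.Subset.Properties using (_∈?_; _⊆?_; anySubset?; nonempty?)
open import Data.List using (List; []; _∷_; _++_; [_]; length; map; filter; reverse; allFin; cartesianProduct)
open import Data.List.Extrema.Nat using (max)
open import Data.List.Properties using (unfold-reverse; reverse-++; length-++)
open import Data.List.Relation.Unary.All using (All; []; _∷_) renaming (all? to allOf?; lookup to lookupAll)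
open import Data.List.Relation.Unary.All.Properties using (++⁻ʳ)
open import Data.List.Relation.Unary.AllPairs using (AllPairs; []; _∷_; allPairs?)
open import Data.List.Relation.Unary.Linked using (Linked; []; [-]; _∷_; linked?)
open import Data.List.Relation.Unary.Unique.Propositional using (Unique)
open import Data.List.Relation.Binary.Permutation.Propositional using (↭-sym; ↭⇒↭ₛ)
open import Data.List.Relation.Binary.Permutation.Propositional.Properties using (↭-reverse; All-resp-↭)
open import Data.List.Relation.Binary.Permutation.Setoid.Properties using (Unique-resp-↭)
open import Data.List.Membership.Propositional.Properties using (∈-lookup)
open import Data.Nat using (ℕ; zero; suc; _∸_; _≤_; z≤n; s≤s)
import Data.Nat.Properties as ℕ
open import Data.Product using (Σ; ∃; _×_; _,_; proj₁; proj₂)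
open import Data.Sum using (_⊎_; inj₁; inj₂)
open import Data.Vec using (_∷_; lookup; tabulate)
import Data.Vec.Properties as Vec
open import Function using (_∘_; _⤖_; Bijection)
open import Level using (0ℓ)
open import Relation.Binary using (Rel; Symmetric; Irreflexive)
open import Relation.Binary.PropositionalEquality using (_≡_; _≢_; refl; sym; trans; cong; subst; setoid)
open import Relation.Nullary using (¬_; Dec; yes; no; does; ¬?; _×-dec_; _⊎-dec_; _→-dec_)
open import Relation.Nullary.Decidable using (map′; decidable-stable)
import Relation.Binary as B
open import Relation.Unary using (Decidable)

Searchable : Set → Set₁
Searchable A = {P : A → Set} → Decidable P → Dec (∃ P)

searchPair : ∀ {A B} → Searchable A → Searchable B → Searchable (A × B)
searchPair sA sB P? =
  map′ (λ (a , b , p) → (a , b) , p) (λ ((a , b) , p) → a , b , p)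
       (sA (λ a → sB (λ b → P? (a , b))))

searchList : ∀ {A} {P : List A → Set} → Searchable A → Decidable P →
             ∀ k → Dec (∃ λ xs → length xs ≤ k × P xs)
searchList sA P? zero =
  map′ (λ p → [] , z≤n , p) (λ { ([] , _ , p) → p }) (P? [])
searchList sA P? (suc k) =
  map′ (λ { (inj₁ p) → [] , z≤n , p
          ; (inj₂ (x , xs , l , p)) → x ∷ xs , s≤s l , p })
       (λ { ([] , _ , p) → inj₁ p
          ; (x ∷ xs , s≤s l , p) → inj₂ (x , xs , l , p) })
       (P? [] ⊎-dec sA (λ x → searchList sA (P? ∘ (x ∷_)) k))

searchAllSubsets : ∀ {n} {P : Subset n → Set} → Decidable P → Dec (∀ p → P p)
searchAllSubsets P? =
  map′ (λ none p → decidable-stable (P? p) (λ ¬p → none (p , ¬p)))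
       (λ all (p , ¬p) → ¬p (all p))
       (¬? (anySubset? (¬? ∘ P?)))

-- The largest k ≤ b with P k (0 if there is none).
largest : {P : ℕ → Set} → Decidable P → (b : ℕ) → ℕ
largest P? zero    = zero
largest P? (suc b) = if does (P? (suc b)) then suc b else largest P? b

-- A parameter that is a minimum is represented by the set W of numbers it is
-- the minimum of: constructively, a nonempty W need not have a least element
-- that can be exhibited.

infix 4 min_≤_ min_≥_ min_≡_

min_≤_ min_≥_ min_≡_ : (ℕ → Set₁) → ℕ → Set₁
min W ≤ k = ∃ λ w → W w × w ≤ k
min W ≥ k = ∀ w → W w → k ≤ w
min W ≡ k = W k × min W ≥ k

record Graph : Set₁ where
  infix 4 _~_ _~?_
  field
    order : ℕ
    _~_   : Rel (Fin order) 0ℓ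
    _~?_  : B.Decidable _~_
    sym~  : Symmetric _~_
    irr~  : Irreflexive _≡_ _~_

  N : Fin order → Subset order
  N v = tabulate (λ w → does (v ~? w))

  degree : Fin order → ℕ
  degree v = ∣ N v ∣

  edges : List (Fin order × Fin order)
  edges = filter (λ (v , w) → v ~? w) (cartesianProduct (allFin order) (allFin order))

open Graph using (order)

V : Graph → Set
V G = Fin (order G)

-- The increasing enumeration of a subset; it renumbers the vertices of induced
-- subgraphs, submatrices and collapsed graphs.
nth : ∀ {n} (p : Subset n) → Fin ∣ p ∣ → Fin n
nth (inside  ∷ p) zero    = zero
nth (inside  ∷ p) (suc i) = suc (nth p i)
nth (outside ∷ p) i       = suc (nth p i)

infixl 9 _[_]ᵍ

_[_]ᵍ : (G : Graph) → Subset (order G) → Graph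
G [ X ]ᵍ = record
  { order = ∣ X ∣
  ; _~_   = λ i j → nth X i ~ nth X j
  ; _~?_  = λ i j → nth X i ~? nth X j
  ; sym~  = sym~
  ; irr~  = λ { refl → irr~ refl }
  } where open Graph G hiding (order)

_─ᵉ_ : (G : Graph) → V G × V G → Graph
G ─ᵉ (x , y) = record
  { order = order G
  ; _~_   = λ u v → u ~ v × ¬ Is u v
  ; _~?_  = λ u v → u ~? v ×-dec ¬? ((u ≟ x ×-dec v ≟ y) ⊎-dec (u ≟ y ×-dec v ≟ x))
  ; sym~  = λ (u~v , ¬is) → sym~ u~v , λ { (inj₁ (p , q)) → ¬is (inj₂ (q , p))
                                         ; (inj₂ (p , q)) → ¬is (inj₁ (q , p)) }
  ; irr~  = λ eq (u~v , _) → irr~ eq u~v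
  }
  where
  open Graph G hiding (order)
  Is : V G → V G → Set
  Is u v = (u ≡ x × v ≡ y) ⊎ (u ≡ y × v ≡ x)

unique⇒length≤ : ∀ {n} {xs : List (Fin n)} → Unique xs → length xs ≤ n
unique⇒length≤ {xs = xs} u = injective⇒≤ (lookup-inj u)
  where
  lookup-inj : ∀ {A : Set} {xs : List A} → Unique xs → ∀ {i j} →
               Data.List.lookup xs i ≡ Data.List.lookup xs j → i ≡ j
  lookup-inj (_ ∷ _)  {zero}  {zero}  _  = refl
  lookup-inj (x ∷ _)  {zero}  {suc j} eq = ⊥-elim (lookupAll x (∈-lookup j) eq)
  lookup-inj (x ∷ _)  {suc i} {zero}  eq = ⊥-elim (lookupAll x (∈-lookup i) (sym eq))
  lookup-inj (_ ∷ us) {suc i} {suc j} eq = cong suc (lookup-inj us eq)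

reverse-path : ∀ {A : Set} (u : A) xs v → reverse (u ∷ xs ++ [ v ]) ≡ v ∷ reverse xs ++ [ u ]
reverse-path u xs v =
  trans (unfold-reverse u (xs ++ [ v ])) (cong (_++ [ u ]) (reverse-++ xs [ v ]))

linked-snoc : ∀ {A : Set} {_~_ : Rel A 0ℓ} (xs : List A) {y z} → Linked _~_ (xs ++ [ y ]) → y ~ z → Linked _~_ ((xs ++ [ y ]) ++ [ z ])
linked-snoc []           [-]      yz = yz ∷ [-]
linked-snoc (x ∷ [])     (r ∷ rs) yz = r ∷ linked-snoc [] rs yz
linked-snoc (x ∷ w ∷ xs) (r ∷ rs) yz = r ∷ linked-snoc (w ∷ xs) rs yz

linked-reverse : ∀ {A : Set} {_~_ : Rel A 0ℓ} → Symmetric _~_ → ∀ {xs} → Linked _~_ xs → Linked _~_ (reverse xs)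
linked-reverse s []  = []
linked-reverse s [-] = [-]
linked-reverse {_~_ = _~_} s {x ∷ y ∷ xs} (r ∷ rs) =
  subst (Linked _~_) (sym (trans (unfold-reverse x (y ∷ xs)) (cong (_++ [ x ]) (unfold-reverse y xs))))
    (linked-snoc (reverse xs) (subst (Linked _~_) (unfold-reverse y xs) (linked-reverse s rs)) (s r))

module _ (G : Graph) where
  open Graph G using (_~_; _~?_; sym~)

  IsPath : List (V G) → Set
  IsPath vs = Linked _~_ vs × Unique vs

  -- A path between u and v (necessarily distinct) whose internal vertices
  -- are in X.
  PathThrough : Subset (order G) → V G → V G → Set
  PathThrough X u v = ∃ λ xs → All (_∈ X) xs × IsPath (u ∷ xs ++ [ v ])

  IsCycle : List (V G) → Set
  IsCycle []       = ⊥
  IsCycle (x ∷ xs) = 2 ≤ length xs × Unique (x ∷ xs) × Linked _~_ (x ∷ xs ++ [ x ])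

  Joined : V G → V G → Set
  Joined u v = u ≡ v ⊎ PathThrough full u v

  pathThrough-sym : ∀ X → Symmetric (PathThrough X)
  pathThrough-sym X {u} {v} (xs , xs⊆X , linked , unique) =
    reverse xs ,
    All-resp-↭ (↭-sym (↭-reverse xs)) xs⊆X ,
    subst (Linked _~_) (reverse-path u xs v) (linked-reverse sym~ linked) ,
    subst Unique (reverse-path u xs v)
      (Unique-resp-↭ (setoid (V G)) (↭⇒↭ₛ (↭-sym (↭-reverse (u ∷ xs ++ [ v ])))) unique)

  pathThrough-irr : ∀ X → Irreflexive _≡_ (PathThrough X)
  pathThrough-irr X refl (xs , _ , _ , u≢ ∷ _) with ++⁻ʳ xs u≢
  ... | u≢u ∷ [] = u≢u refl

  pathThrough? : ∀ X → B.Decidable (PathThrough X)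
  pathThrough? X u v =
    map′ (λ (xs , _ , p) → xs , p) (λ (xs , p) → xs , bound xs p , p)
      (searchList any?
        (λ xs → allOf? (_∈? X) xs ×-dec linked? _~?_ (u ∷ xs ++ [ v ])
                ×-dec allPairs? (λ x y → ¬? (x ≟ y)) (u ∷ xs ++ [ v ]))
        (order G))
    where
    bound : ∀ xs → All (_∈ X) xs × IsPath (u ∷ xs ++ [ v ]) → length xs ≤ order G
    bound xs (_ , _ , unique) =
      ℕ.≤-trans (subst (length xs ≤_) (sym (length-++ xs)) (ℕ.m≤m+n _ 1))
        (ℕ.≤-trans (ℕ.n≤1+n _) (unique⇒length≤ unique))

  joined? : B.Decidable Joined
  joined? u v = (u ≟ v) ⊎-dec pathThrough? full u v

  Connected : Set
  Connected = ∀ u v → Joined u v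

  component : V G → Subset (order G)
  component u = tabulate (λ v → does (joined? u v))

  -- The graph without vertices counts as a tree; this is what gives the
  -- empty graph rank-width, branch-width and treewidth 0.
  IsTree : Set
  IsTree = Connected × (∀ xs → ¬ IsCycle xs)

  -- The only node of a one-node tree is a leaf.
  Leaf : Set
  Leaf = ∃ λ x → Graph.degree G x ≤ 1

record BranchDecomposition (G : Graph) : Set₁ where
  field
    T        : Graph
    isTree   : IsTree T
    degree≤3 : ∀ x → Graph.degree T x ≤ 3
    leaves   : V G ⤖ Leaf T

  μ : V G → V T
  μ v = proj₁ (Bijection.to leaves v)

  -- The vertices at the leaves in the component of T - xy containing x.
  cut : V T × V T → Subset (order G)
  cut (x , y) = tabulate (λ v → lookup (component (T ─ᵉ (x , y)) x) (μ v))

  -- Each edge xy occurs in both orders in edges T, so that both sides of its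
  -- bipartition are taken into account.
  width : (Subset (order G) → ℕ) → ℕ
  width κ = max 0 (map (κ ∘ cut) (Graph.edges T))

branchWidth : (G : Graph) → (Subset (order G) → ℕ) → ℕ → Set₁
branchWidth G κ w = Σ (BranchDecomposition G) λ D → BranchDecomposition.width D κ ≡ w

module GF2 = CommutativeRing xor-∧-commutativeRing
open import Algebra.Properties.Semiring.Sum GF2.semiring using (sum)

Matrix : ℕ → ℕ → Set
Matrix m n = Fin m → Fin n → Bool

module _ {m n} (M : Matrix m n) where

  LinearlyIndependentRows : Subset m → Set
  LinearlyIndependentRows S =
    ∀ (a : Subset m) → a ⊆ S → (∀ j → sum (λ i → lookup a i GF2.* M i j) ≡ GF2.0#) → a ≡ ∅

  linearlyIndependentRows? : Decidable LinearlyIndependentRows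
  linearlyIndependentRows? S = searchAllSubsets (λ a →
    (a ⊆? S) →-dec (all? (λ j → sum (λ i → lookup a i GF2.* M i j) ≟ᵇ GF2.0#) →-dec Vec.≡-dec _≟ᵇ_ a ∅))

  rank : ℕ
  rank = largest
    {λ k → ∃ λ S → ∣ S ∣ ≡ k × LinearlyIndependentRows S}
    (λ k → anySubset? (λ S → (∣ S ∣ ℕ.≟ k) ×-dec linearlyIndependentRows? S))
    m

cutRank : (G : Graph) → Subset (order G) → ℕ
cutRank G U = rank {∣ U ∣} {∣ ∁ U ∣} (λ i j → does (nth U i ~? nth (∁ U) j))
  where open Graph G hiding (order)

rankWidth : Graph → ℕ → Set₁
rankWidth G = branchWidth G (cutRank G)

𝓡 : ℕ → Graph → Set₁
𝓡 c G = min rankWidth G ≤ c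

record TreeDecomposition (G : Graph) : Set₁ where
  open Graph G using (_~_)
  field
    T         : Graph
    isTree    : IsTree T
    bag       : V T → Subset (order G)
    vertices  : ∀ v → ∃ λ x → v ∈ bag x
    edges     : ∀ {u v} → u ~ v → ∃ λ x → u ∈ bag x × v ∈ bag x
    connected : ∀ v → Connected (T [ tabulate (λ x → lookup (bag x) v) ]ᵍ)

  width : ℕ
  width = max 0 (map (λ x → ∣ bag x ∣) (allFin (order T))) ∸ 1

treewidth : Graph → ℕ → Set₁
treewidth G w = Σ (TreeDecomposition G) λ D → TreeDecomposition.width D ≡ w

infixl 9 _∘ᵍ_

_∘ᵍ_ : (G : Graph) → Subset (order G) → Graph
G ∘ᵍ X = record
  { order = ∣ ∁ X ∣
  ; _~_   = λ i j → nth (∁ X) i ≈ nth (∁ X) j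
  ; _~?_  = λ i j → nth (∁ X) i ≈? nth (∁ X) j
  ; sym~  = λ { (inj₁ e)        → inj₁ (sym~ e)
              ; (inj₂ (¬e , p)) → inj₂ (¬e ∘ sym~ , pathThrough-sym G X p) }
  ; irr~  = λ { refl (inj₁ e)       → irr~ refl e
              ; refl (inj₂ (_ , p)) → pathThrough-irr G X refl p }
  }
  where
  open Graph G hiding (order)
  _≈_ : V G → V G → Set
  u ≈ v = u ~ v ⊎ (¬ u ~ v × PathThrough G X u v)
  _≈?_ : B.Decidable _≈_
  u ≈? v = (u ~? v) ⊎-dec (¬? (u ~? v) ×-dec pathThrough? G X u v)

IsTorso : ℕ → (G : Graph) → Subset (order G) → Set₁
IsTorso c G X = ∀ u → 𝓡 c (G[X] [ component G[X] u ]ᵍ)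
  where G[X] = G [ X ]ᵍ

𝓡-treewidth : ℕ → Graph → ℕ → Set₁
𝓡-treewidth c G w = ∃ λ X → IsTorso c G X × min treewidth (G ∘ᵍ X) ≡ w

module _ (G : Graph) (A : Subset (order G)) where
  open Graph G hiding (order)

  IsSplit : Set
  IsSplit = 2 ≤ ∣ A ∣ × 2 ≤ ∣ ∁ A ∣ ×
    (∀ v → v ∈ A → ∀ w → w ∈ A →
     Nonempty (N v ∩ ∁ A) → Nonempty (N w ∩ ∁ A) → N v ∩ ∁ A ≡ N w ∩ ∁ A)

  isSplit? : Dec IsSplit
  isSplit? = (2 ℕ.≤? ∣ A ∣) ×-dec (2 ℕ.≤? ∣ ∁ A ∣) ×-dec
    all? (λ v → (v ∈? A) →-dec all? (λ w → (w ∈? A) →-dec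
      (nonempty? (N v ∩ ∁ A) →-dec (nonempty? (N w ∩ ∁ A) →-dec
        Vec.≡-dec _≟ᵇ_ (N v ∩ ∁ A) (N w ∩ ∁ A)))))

  CutEdge : V G × V G → Set
  CutEdge (a , b) = a ∈ A × b ∈ ∁ A × a ~ b

  Disjoint : Rel (V G × V G) 0ℓ
  Disjoint (a , b) (a′ , b′) = a ≢ a′ × b ≢ b′

  IsMatching : List (V G × V G) → Set
  IsMatching es = All CutEdge es × AllPairs Disjoint es

  isMatching? : Decidable IsMatching
  isMatching? es =
    allOf? (λ (a , b) → (a ∈? A) ×-dec (b ∈? ∁ A) ×-dec (a ~? b)) es ×-dec
    allPairs? (λ (a , b) (a′ , b′) → ¬? (a ≟ a′) ×-dec ¬? (b ≟ b′)) es

  -- No matching has more edges than G has vertices.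
  maxMatching : ℕ
  maxMatching = largest
    {λ k → ∃ λ es → length es ≡ k × IsMatching es}
    (λ k → map′ (λ (es , _ , p) → es , p)
                (λ (es , eq , p) → es , ℕ.≤-reflexive eq , eq , p)
                (searchList (searchPair any? any?) (λ es → (length es ℕ.≟ k) ×-dec isMatching? es) k))
    (order G)

  splitMatching : ℕ
  splitMatching = if does isSplit? then 1 else maxMatching

smw : Graph → ℕ → Set₁
smw G = branchWidth G (splitMatching G)

{-# OPTIONS --safe #-}

-- In a tree, if every node points to an incident edge, then some edge is pointed
-- to from both of its ends.  This gives balanced cuts of branch decompositions
-- (point towards the side with many of the marked leaves) and puts every clique
-- into one bag of a tree decomposition (point towards the bags containing a
-- clique vertex that is missing here).
--
-- (1) Take the 1-subdivision of K_{k,N} with k = c + 1 and N large, join it to an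
-- apex, and make the apices of m copies a clique.  A balanced cut of a copy has
-- an induced matching of size k, one edge in each of k rows or of k columns, so
-- the copy has rank-width more than c and a torso keeps some vertex of it.  In
-- the torso these m vertices form a clique.  On the other hand, unions of copies
-- with their apices are splits, and in a layout of a copy column by column the
-- edges of a cut are covered by the apex, the k hubs of the rows and the hub of
-- one column.
--
-- (2) Blow up the vertices of the 5-cycle to independent sets of size n.  The cuts
-- of the linear layout have rank at most 3, so the whole graph can be collapsed.
-- A cut with more than n vertices on both sides is not a split, because the
-- 5-cycle is prime, and since fewer than n vertices cannot separate the blow-up,
-- a matching in it can be extended greedily up to size n / 2.
module Submission where

open import Defs
open import Algebra.Properties.Semiring.Sum GF2.semiring using (sum)
open import Data.Bool using (Bool; true; false; if_then_else_; _∧_; _xor_) renaming (_≟_ to _≟ᵇ_)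
open import Data.Bool.Properties using (∧-identityʳ; ∧-zeroʳ; xor-identityʳ; xor-same)
open import Data.Empty using (⊥; ⊥-elim)
open import Data.Fin using (Fin; zero; suc; toℕ; fromℕ<; inject≤; punchOut; combine; join; splitAt; _≤?_) renaming (_≟_ to _≟ᶠ_; _≤_ to _≤ᶠ_; _<_ to _<ᶠ_)
open import Data.Fin.Patterns using (0F; 1F; 2F; 3F; 4F)
open import Data.Fin.Properties using (any?; all?; injective⇒≤; suc-injective; inject≤-injective; punchOut-injective; combine-injectiveˡ; combine-injectiveʳ; ¬∀⟶∃¬; +↔⊎; 1↔⊤; *↔×; combine-monoˡ-<; splitAt-join)
open import Data.Fin.Subset using (Subset; inside; outside; _⊆_; ∁; ∣_∣; _∩_; ⁅_⁆; _∪_; Nonempty) renaming (_∈_ to _∈ₛ_; _∉_ to _∉ₛ_; ⊤ to full)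
open import Data.Fin.Subset.Properties using (p⊂q⇒∣p∣<∣q∣; x∉p⇒x∈∁p; x∈∁p⇒x∉p; x∉∁p⇒x∈p; ∈⊤; ∣p∣≤n; ⊆-antisym; x∈p∩q⁺; x∈p∩q⁻; x∈⁅x⁆; x∈⁅y⁆⇒x≡y; x∈p∪q⁺; x∈p∪q⁻; ∉⊥; p⊆q⇒∣p∣≤∣q∣; ∣∁p∣≡n∸∣p∣) renaming (_∈?_ to _∈ₛ?_)
open import Data.List using (List; []; _∷_; _++_; [_]; length; map; allFin; cartesianProduct) renaming (lookup to lookupₗ)
open import Data.List.Extrema.Nat using (xs≤max; max≤v⁺)
open import Data.List.Membership.DecPropositional using () renaming (_∈?_ to member?)
open import Data.List.Membership.Propositional using () renaming (_∈_ to _∈ₗ_)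
open import Data.List.Membership.Propositional.Properties using (∈-filter⁺; ∈-filter⁻; ∈-cartesianProduct⁺; ∈-allFin; ∈-map⁺; ∈-lookup; ∈-++⁺ˡ; ∈-++⁺ʳ)
open import Data.List.Properties using (length-map; length-++; length-tabulate)
open import Data.List.Relation.Unary.All using (All; []; _∷_; universal) renaming (lookup to lookupAll; tabulate to All-tabulate)
open import Data.List.Relation.Unary.All.Properties using (¬Any⇒All¬) renaming (map⁺ to All-map⁺)
open import Data.List.Relation.Unary.AllPairs using ([]; _∷_; AllPairs) renaming (map to mapAllPairs)
open import Data.List.Relation.Unary.AllPairs.Properties using () renaming (map⁺ to allPairs-map⁺)
open import Data.List.Relation.Unary.Any using (here; there)
open import Data.List.Relation.Unary.Linked using (Linked; []; [-]; _∷_) renaming (map to mapLinked)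
open import Data.List.Relation.Unary.Unique.Propositional using (Unique)
open import Data.Nat using (ℕ; zero; suc; _+_; _*_; _∸_; _≤_; _<_; z≤n; s≤s; nonZero)
open import Data.Nat.Induction using (<-wellFounded)
import Data.Nat.Properties as ℕ
open import Data.Product using (∃; ∃₂; _×_; _,_; proj₁; proj₂)
open import Data.Product.Function.NonDependent.Propositional using (_×-↔_)
open import Data.Sum using (_⊎_; inj₁; inj₂; [_,_]′)
open import Data.Sum.Function.Propositional using (_⊎-↔_)
open import Data.Sum.Properties using (inj₂-injective)
open import Data.Unit using (⊤; tt)
open import Data.Vec using (tabulate; lookup; _∷_; []; here; there; Vec)
open import Data.Vec.Properties using (lookup⇒[]=; []=⇒lookup; lookup∘tabulate)
open import Function using (_∘_; id; Bijection; mk⤖; _↔_; Inverse; mk↔ₛ′)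
open import Function.Construct.Composition using (_↔-∘_)
open import Function.Construct.Identity using (↔-id)
open import Function.Construct.Symmetry using (↔-sym)
open import Induction.WellFounded using (Acc; acc)
open import Relation.Binary.Construct.Closure.ReflexiveTransitive using (Star; ε; _◅_; _◅◅_; gmap; reverse)
open import Relation.Binary.PropositionalEquality using (_≡_; _≢_; refl; sym; trans; cong; cong₂; subst; subst₂)
open import Relation.Nullary using (¬_; Dec; yes; no; does; ¬?; contradiction; _×-dec_; _⊎-dec_; _→-dec_)
open import Relation.Nullary.Decidable using (dec-true; dec-false; toWitness; map′; decidable-stable)
open import Relation.Unary using (Decidable)

-- Subsets of finite types and counting by injections.

module _ {n} {P : Fin n → Set} (P? : Decidable P) where

  ⟪_⟫ : Subset n
  ⟪_⟫ = tabulate (does ∘ P?)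

  ∈⟪⟫⁺ : ∀ {x} → P x → x ∈ₛ ⟪_⟫
  ∈⟪⟫⁺ {x} px = lookup⇒[]= x _ (trans (lookup∘tabulate _ x) (dec-true (P? x) px))

  ∈⟪⟫⁻ : ∀ {x} → x ∈ₛ ⟪_⟫ → P x
  ∈⟪⟫⁻ {x} x∈ with P? x | trans (sym (lookup∘tabulate (does ∘ P?) x)) ([]=⇒lookup x∈)
  ... | yes px | _ = px

∈-tabulate⁺ : ∀ {n} {f : Fin n → Bool} {x} → f x ≡ true → x ∈ₛ tabulate f
∈-tabulate⁺ {x = x} e = lookup⇒[]= x _ (trans (lookup∘tabulate _ x) e)

∈-tabulate⁻ : ∀ {n} {f : Fin n → Bool} {x} → x ∈ₛ tabulate f → f x ≡ true
∈-tabulate⁻ {f = f} {x} x∈ = trans (sym (lookup∘tabulate f x)) ([]=⇒lookup x∈)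

-- The partial inverse of `nth`: it takes vertices of a graph into induced subgraphs, cut matrices
-- and collapsed graphs.
index : ∀ {n} (p : Subset n) {x} → x ∈ₛ p → Fin ∣ p ∣
index (inside  ∷ p) here       = zero
index (inside  ∷ p) (there x∈) = suc (index p x∈)
index (outside ∷ p) (there x∈) = index p x∈

nth-index : ∀ {n} (p : Subset n) {x} (x∈ : x ∈ₛ p) → nth p (index p x∈) ≡ x
nth-index (inside  ∷ p) here       = refl
nth-index (inside  ∷ p) (there x∈) = cong suc (nth-index p x∈)
nth-index (outside ∷ p) (there x∈) = cong suc (nth-index p x∈)

nth-∈ : ∀ {n} (p : Subset n) i → nth p i ∈ₛ p
nth-∈ (inside  ∷ p) zero    = here
nth-∈ (inside  ∷ p) (suc i) = there (nth-∈ p i)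
nth-∈ (outside ∷ p) i       = there (nth-∈ p i)

nth-injective : ∀ {n} (p : Subset n) {i j} → nth p i ≡ nth p j → i ≡ j
nth-injective (inside  ∷ p) {zero}  {zero}  e = refl
nth-injective (inside  ∷ p) {suc i} {suc j} e = cong suc (nth-injective p (suc-injective e))
nth-injective (outside ∷ p) {i}     {j}     e = nth-injective p (suc-injective e)

-- Lets induced subgraphs inherit a vertex numbering that goes bag by bag, see `induced-bagged`.
nth-mono : ∀ {n} (p : Subset n) {i j} → i ≤ᶠ j → nth p i ≤ᶠ nth p j
nth-mono (inside  ∷ p) {zero}  {j}     _       = z≤n
nth-mono (inside  ∷ p) {suc i} {suc j} (s≤s l) = s≤s (nth-mono p l)
nth-mono (outside ∷ p) {i}     {j}     l       = s≤s (nth-mono p l)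

index-injective : ∀ {n} (p : Subset n) {x y} (x∈ : x ∈ₛ p) (y∈ : y ∈ₛ p) →
                  index p x∈ ≡ index p y∈ → x ≡ y
index-injective p x∈ y∈ e =
  trans (sym (nth-index p x∈)) (trans (cong (nth p) e) (nth-index p y∈))

injection⇒≤∣p∣ : ∀ {k n} (p : Subset n) (f : Fin k → Fin n) →
                 (∀ {i j} → f i ≡ f j → i ≡ j) → (∀ i → f i ∈ₛ p) → k ≤ ∣ p ∣
injection⇒≤∣p∣ p f f-inj f∈ =
  injective⇒≤ {f = λ i → index p (f∈ i)} (λ e → f-inj (index-injective p _ _ e))

injection⇒∣p∣≤ : ∀ {k n} (p : Subset n) (f : ∀ {x} → x ∈ₛ p → Fin k) →
                 (∀ {x y} (x∈ : x ∈ₛ p) (y∈ : y ∈ₛ p) → f x∈ ≡ f y∈ → x ≡ y) → ∣ p ∣ ≤ k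
injection⇒∣p∣≤ p f f-inj =
  injective⇒≤ {f = λ i → f (nth-∈ p i)} (λ e → nth-injective p (f-inj _ _ e))

∈⇒index : ∀ {A : Set} {x : A} {xs} → x ∈ₗ xs → Fin (length xs)
∈⇒index (here _)  = zero
∈⇒index (there m) = suc (∈⇒index m)

∈⇒index-injective : ∀ {A : Set} {x y : A} {xs} (x∈ : x ∈ₗ xs) (y∈ : y ∈ₗ xs) →
                    ∈⇒index x∈ ≡ ∈⇒index y∈ → x ≡ y
∈⇒index-injective (here refl) (here refl) _ = refl
∈⇒index-injective (there p)   (there q)   e = ∈⇒index-injective p q (suc-injective e)

module _ {P : ℕ → Set} (P? : Decidable P) where

  largest-≥ : ∀ {k} b → P k → k ≤ b → k ≤ largest P? b
  largest-≥ zero    pk k≤b = k≤b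
  largest-≥ (suc b) pk k≤b with P? (suc b)
  ... | yes _ = k≤b
  ... | no ¬p = largest-≥ b pk (ℕ.≤-pred (ℕ.≤∧≢⇒< k≤b λ { refl → ¬p pk }))

  largest-≤ : ∀ {r} b → (∀ k → P k → k ≤ r) → largest P? b ≤ r
  largest-≤ zero    bound = z≤n
  largest-≤ (suc b) bound with P? (suc b)
  ... | yes p = bound _ p
  ... | no _  = largest-≤ b bound

-- Walks and trees

module Walks (G : Graph) where
  open Graph G using (_~_; sym~; irr~)

  Walk : V G → V G → Set
  Walk = Star _~_

  -- Keeps the list of visited vertices, so that a repeated vertex can be found and the loop cut
  -- out.
  data Trail (v : V G) : V G → List (V G) → Set where
    stop : Trail v v [ v ]
    step : ∀ {u w ws} → u ~ w → Trail v w ws → Trail v u (u ∷ ws)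

  private
    shortcut : ∀ {u w v ws} → Trail v w ws → Unique ws → u ∈ₗ ws → ∃ λ ws′ → Trail v u ws′ × Unique ws′
    shortcut stop       uq       (here refl) = _ , stop , uq
    shortcut (step e t) uq       (here refl) = _ , step e t , uq
    shortcut (step e t) (_ ∷ uq) (there m)   = shortcut t uq m

    loopErase : ∀ {u v} → Walk u v → ∃ λ ws → Trail v u ws × Unique ws
    loopErase ε = _ , stop , [] ∷ []
    loopErase {u} (e ◅ s) with loopErase s
    ... | ws , t , uq with member? _≟ᶠ_ u ws
    ...   | yes m = shortcut t uq m
    ...   | no ¬m = _ , step e t , ¬Any⇒All¬ ws ¬m ∷ uq

    trail-linked : ∀ {u v ws} → Trail v u ws → Linked _~_ ws
    trail-linked stop                  = [-]
    trail-linked (step e stop)         = e ∷ [-]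
    trail-linked (step e t@(step _ _)) = e ∷ trail-linked t

    trail-last : ∀ {u v ws} → Trail v u ws → ∃ λ xs → ws ≡ xs ++ [ v ]
    trail-last stop       = [] , refl
    trail-last (step _ t) with trail-last t
    ... | xs , refl = _ ∷ xs , refl

    trail-ends : ∀ {u v ws} → Trail v u ws → u ≡ v ⊎ ∃ λ xs → ws ≡ u ∷ xs ++ [ v ]
    trail-ends stop       = inj₁ refl
    trail-ends (step e t) with trail-last t
    ... | xs , refl = inj₂ (xs , refl)

  -- Walks compose freely, whereas the paths of `Joined` must not repeat vertices. Connectivity is
  -- therefore argued with walks, and loop erasure leads back to paths.
  walk⇒joined : ∀ {u v} → Walk u v → Joined G u v
  walk⇒joined s with loopErase s
  ... | ws , t , uq with trail-ends t
  ...   | inj₁ e           = inj₁ e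
  ...   | inj₂ (xs , refl) = inj₂ (xs , universal (λ _ → ∈⊤) xs , trail-linked t , uq)

  linked⇒walk : ∀ {u v} xs → Linked _~_ (u ∷ xs ++ [ v ]) → Walk u v
  linked⇒walk []       (e ∷ _) = e ◅ ε
  linked⇒walk (x ∷ xs) (e ∷ l) = e ◅ linked⇒walk xs l

  joined⇒walk : ∀ {u v} → Joined G u v → Walk u v
  joined⇒walk (inj₁ refl)             = ε
  joined⇒walk (inj₂ (xs , _ , l , _)) = linked⇒walk xs l

  flip : ∀ {u v} → Walk u v → Walk v u
  flip = reverse sym~

  ∈component⁺ : ∀ {u v} → Walk u v → v ∈ₛ component G u
  ∈component⁺ s = ∈⟪⟫⁺ (joined? G _) (walk⇒joined s)

  ∈component⁻ : ∀ {u v} → v ∈ₛ component G u → Walk u v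
  ∈component⁻ m = joined⇒walk (∈⟪⟫⁻ (joined? G _) m)

open Walks

module Sides (T : Graph) where
  open Graph T using (_~_; sym~)

  -- The first argument is the end of the removed edge whose component is meant, as in `cut`.
  Side : V T → V T → V T → Set
  Side x y = Walk (T ─ᵉ (x , y)) x

  side? : ∀ x y → Decidable (Side x y)
  side? x y u = map′ (joined⇒walk (T ─ᵉ (x , y))) (walk⇒joined (T ─ᵉ (x , y))) (joined? (T ─ᵉ (x , y)) x u)

  swap : ∀ {x y u v} → Walk (T ─ᵉ (x , y)) u v → Walk (T ─ᵉ (y , x)) u v
  swap = gmap id λ (e , ¬is) → e , λ { (inj₁ p) → ¬is (inj₂ p) ; (inj₂ p) → ¬is (inj₁ p) }

  -- Follow a walk from `u` to `x` backwards: each step stays on the side reached so far unless it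
  -- is the edge `xy`, and the ends of that edge lie on their own sides.
  side-cover : ∀ {x y} → x ~ y → Connected T → ∀ u → Side x y u ⊎ Side y x u
  side-cover {x} {y} x~y conn u = go (joined⇒walk T (conn u x))
    where
    go : ∀ {u} → Walk T u x → Side x y u ⊎ Side y x u
    go ε = inj₁ ε
    go {u} (_◅_ {j = w} e s) with (u ≟ᶠ x ×-dec w ≟ᶠ y) ⊎-dec (u ≟ᶠ y ×-dec w ≟ᶠ x)
    ... | yes (inj₁ (refl , refl)) = inj₁ ε
    ... | yes (inj₂ (refl , refl)) = inj₂ ε
    ... | no ¬is with go s
    ...   | inj₁ p = inj₁ (p ◅◅ (sym~ e , λ { (inj₁ (p , q)) → ¬is (inj₂ (q , p))
                                           ; (inj₂ (p , q)) → ¬is (inj₁ (q , p)) }) ◅ ε)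
    ...   | inj₂ p = inj₂ (p ◅◅ (sym~ e , λ { (inj₁ (p , q)) → ¬is (inj₁ (q , p))
                                           ; (inj₂ (p , q)) → ¬is (inj₂ (q , p)) }) ◅ ε)

  branch : Connected T → ∀ x u → u ≡ x ⊎ ∃ λ z → x ~ z × Side z x u
  branch conn x u = go (joined⇒walk T (conn u x))
    where
    go : ∀ {u} → Walk T u x → u ≡ x ⊎ ∃ λ z → x ~ z × Side z x u
    go ε = inj₁ refl
    go {u} (_◅_ {j = w} e s) with u ≟ᶠ x
    ... | yes u≡x = inj₁ u≡x
    ... | no u≢x with go s
    ...   | inj₁ refl = inj₂ (u , sym~ e , ε)
    -- A step between two nodes other than `x` cannot be the removed edge. If `w` is `x`, then `u`
    -- is a neighbour of `x` and takes the place of `z`.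
    ...   | inj₂ (z , x~z , p) with w ≟ᶠ x
    ...     | yes refl = inj₂ (u , sym~ e , ε)
    ...     | no w≢x   = inj₂ (z , x~z , p ◅◅ (sym~ e , λ { (inj₁ (_ , q)) → u≢x q ; (inj₂ (q , _)) → w≢x q }) ◅ ε)

module Trees {T : Graph} (tree : IsTree T) where
  open Graph T using (_~_; sym~; irr~)
  open Sides T public

  conn : Connected T
  conn = proj₁ tree

  -- A node on both sides would give a path from `x` to `y` that avoids the edge `xy`, and this edge
  -- would close it to a cycle.
  side-disjoint : ∀ {x y} → x ~ y → ∀ {u} → Side x y u → Side y x u → ⊥
  side-disjoint {x} {y} x~y p q with walk⇒joined (T ─ᵉ (x , y)) (p ◅◅ flip (T ─ᵉ (x , y)) (swap q))
  ... | inj₁ refl = irr~ refl x~y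
  ... | inj₂ ([] , _ , ((_ , ¬is) ∷ _) , _) = ¬is (inj₁ (refl , refl))
  ... | inj₂ (w ∷ ws , _ , l , uq) =
    proj₂ tree (x ∷ w ∷ ws ++ [ y ])
      (s≤s (len ws) , uq ,
       linked-snoc (x ∷ w ∷ ws) (mapLinked proj₁ l) (sym~ x~y))
    where
    len : ∀ (ws : List (V T)) → 1 ≤ length (ws ++ [ y ])
    len []      = s≤s z≤n
    len (_ ∷ _) = s≤s z≤n

  -- The side of `w` does not contain `z`, so a walk in it never uses the edge `xz`.
  side-nest : ∀ {x z w} → x ~ z → z ~ w → w ≢ x → ∀ {u} → Side w z u → Side z x u
  side-nest {x} {z} {w} x~z z~w w≢x p =
    (z~w , λ { (inj₁ (_ , q)) → w≢x q ; (inj₂ (q , _)) → irr~ (sym q) x~z }) ◅ go ε p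
    where
    go : ∀ {a u} → Side w z a → Walk (T ─ᵉ (w , z)) a u → Walk (T ─ᵉ (z , x)) a u
    go r ε = ε
    go {a} r (_◅_ {j = b} e s) =
      (proj₁ e , λ { (inj₁ (refl , _)) → side-disjoint (sym~ z~w) r ε
                   ; (inj₂ (_ , refl)) → side-disjoint (sym~ z~w) (r ◅◅ e ◅ ε) ε })
      ◅ go (r ◅◅ e ◅ ε) s

  -- Following the chosen edges without turning back, one enters ever smaller
  -- sides, so that some edge is chosen from both of its ends.
  mutualEdge : {Q : V T → V T → Set} → (∀ x → ∃ λ z → x ~ z × Q x z) → V T →
               ∃₂ λ x z → x ~ z × Q x z × Q z x
  mutualEdge {Q} next x₀ = let z , x~z , q = next x₀ in go x~z q (<-wellFounded _)
    where
    go : ∀ {x z} → x ~ z → Q x z → Acc _<_ ∣ ⟪ side? z x ⟫ ∣ → ∃₂ λ x z → x ~ z × Q x z × Q z x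
    go {x} {z} x~z q (acc rs) with next z
    ... | w , z~w , q′ with w ≟ᶠ x
    ...   | yes refl = x , z , x~z , q , q′
    ...   | no w≢x   = go z~w q′ (rs (p⊂q⇒∣p∣<∣q∣
      ( (λ m → ∈⟪⟫⁺ (side? z x) (side-nest x~z z~w w≢x (∈⟪⟫⁻ (side? w z) m)))
      , z , ∈⟪⟫⁺ (side? z x) ε , λ m → side-disjoint (sym~ z~w) (∈⟪⟫⁻ (side? w z) m) ε)))

-- Balanced cuts

module _ {T : Graph} (tree : IsTree T) (degree≤3 : ∀ x → Graph.degree T x ≤ 3) where
  open Graph T using (_~_; _~?_; sym~; N; degree)
  open Trees tree

  module _ {n s : ℕ} (ν : Fin n → V T) (ν-inj : ∀ {i j} → ν i ≡ ν j → i ≡ j) (3t≤n : 3 * suc s ≤ n) where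

    private
      W : V T → V T → Subset n
      W x y = ⟪ side? x y ∘ ν ⟫

      Few : V T → V T → Set
      Few x y = ∣ W x y ∣ ≤ s

      W⊆∁W : ∀ {x y} → x ~ y → W x y ⊆ ∁ (W y x)
      W⊆∁W x~y m = x∉p⇒x∈∁p λ m′ →
        side-disjoint x~y (∈⟪⟫⁻ (side? _ _ ∘ ν) m) (∈⟪⟫⁻ (side? _ _ ∘ ν) m′)

      ∁W⊆W : ∀ {x y} → x ~ y → ∁ (W x y) ⊆ W y x
      ∁W⊆W {x} {y} x~y {h} m with side-cover x~y conn (ν h)
      ... | inj₁ p = contradiction (∈⟪⟫⁺ (side? x y ∘ ν) p) (x∈∁p⇒x∉p m)
      ... | inj₂ q = ∈⟪⟫⁺ (side? y x ∘ ν) q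

      Place : V T → Fin n → Set
      Place x h = ν h ≡ x ⊎ ∃ λ z → x ~ z × Side z x (ν h)

      module _ {x} (few : ∀ {z} → x ~ z → Few z x) where

        -- With at most `s` marked nodes behind each neighbour of `x`, the marked nodes inject into
        -- one place for `x` itself and a block of size `s` for each neighbour. So there are at most
        -- 1 + 3s of them.
        code : ∀ {h} → Place x h → Fin (suc (degree x * s))
        code (inj₁ _)               = zero
        code (inj₂ (z , x~z , p)) =
          suc (combine (index (N x) (∈⟪⟫⁺ (x ~?_) x~z))
                       (inject≤ (index (W z x) (∈⟪⟫⁺ (side? z x ∘ ν) p)) (few x~z)))

        code-injective : ∀ {h h′} (c : Place x h) (c′ : Place x h′) → code c ≡ code c′ → h ≡ h′
        code-injective (inj₁ e) (inj₁ e′) _ = ν-inj (trans e (sym e′))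
        code-injective (inj₂ (z , x~z , p)) (inj₂ (z′ , x~z′ , p′)) e
          with index-injective (N x) (∈⟪⟫⁺ (x ~?_) x~z) (∈⟪⟫⁺ (x ~?_) x~z′)
                 (combine-injectiveˡ {m = degree x} {n = s} _ _ _ _ (suc-injective e))
        ... | refl = index-injective (W z x) (∈⟪⟫⁺ (side? z x ∘ ν) p) (∈⟪⟫⁺ (side? z x ∘ ν) p′)
          (inject≤-injective (few x~z) (few x~z′) _ _
            (combine-injectiveʳ {m = degree x} {n = s} _ _ _ _ (suc-injective e)))

        tooFew : ⊥
        tooFew = ℕ.<-irrefl refl (begin-strict
          n                     ≤⟨ injective⇒≤ {f = code ∘ place} (λ {h} {h′} → code-injective (place h) (place h′)) ⟩
          suc (degree x * s)    ≤⟨ s≤s (ℕ.*-monoˡ-≤ s (degree≤3 x)) ⟩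
          1 + 3 * s             <⟨ s≤s (ℕ.m<n+m (3 * s) {2} (s≤s z≤n)) ⟩
          3 + 3 * s             ≡⟨ ℕ.*-suc 3 s ⟨
          3 * suc s             ≤⟨ 3t≤n ⟩
          n                     ∎)
          where
          open ℕ.≤-Reasoning
          place : ∀ h → Place x h
          place h = branch conn x (ν h)

    -- Otherwise every edge has few marked nodes on some side. Let `x` point to a neighbour `z` with
    -- few on the side of `x`; it exists, as else there are few behind every neighbour and `tooFew`
    -- applies. An edge pointed to from both ends leaves at most 2s marked nodes in the whole tree.
    balancedEdge : ∃₂ λ x y → x ~ y × suc s ≤ ∣ ⟪ side? x y ∘ ν ⟫ ∣ × suc s ≤ ∣ ∁ ⟪ side? x y ∘ ν ⟫ ∣
    balancedEdge with any? (λ x → any? λ y → (x ~? y) ×-dec (suc s ℕ.≤? ∣ W x y ∣) ×-dec (suc s ℕ.≤? ∣ ∁ (W x y) ∣))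
    ... | yes (x , y , p) = x , y , p
    ... | no unbalanced = ⊥-elim (bothFew (mutualEdge next (ν (fromℕ< (ℕ.≤-trans (s≤s z≤n) 3t≤n)))))
      where
      oneFew : ∀ {x z} → x ~ z → ¬ Few x z → Few z x
      oneFew {x} {z} x~z many with suc s ℕ.≤? ∣ ∁ (W x z) ∣
      ... | yes p = contradiction (x , z , x~z , ℕ.≰⇒> many , p) unbalanced
      ... | no ¬p = ℕ.≤-trans (p⊆q⇒∣p∣≤∣q∣ (W⊆∁W (sym~ x~z))) (ℕ.≤-pred (ℕ.≰⇒> ¬p))

      next : ∀ x → ∃ λ z → x ~ z × Few x z
      next x with any? (λ z → (x ~? z) ×-dec (∣ W x z ∣ ℕ.≤? s))
      ... | yes p = p
      ... | no ¬p = ⊥-elim (tooFew {x} (λ {z} x~z → oneFew x~z (λ few → ¬p (z , x~z , few))))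

      bothFew : ¬ (∃₂ λ x z → x ~ z × Few x z × Few z x)
      bothFew (x , z , x~z , few , few′) = ℕ.<-irrefl refl (begin-strict
        n                              ≡⟨ ℕ.m+[n∸m]≡n (∣p∣≤n (W x z)) ⟨
        ∣ W x z ∣ + (n ∸ ∣ W x z ∣)    ≡⟨ cong (∣ W x z ∣ +_) (∣∁p∣≡n∸∣p∣ (W x z)) ⟨
        ∣ W x z ∣ + ∣ ∁ (W x z) ∣      ≤⟨ ℕ.+-mono-≤ few (ℕ.≤-trans (p⊆q⇒∣p∣≤∣q∣ (∁W⊆W x~z)) few′) ⟩
        s + s                          ≤⟨ ℕ.+-monoʳ-≤ s (ℕ.m≤m+n s (1 * s)) ⟩
        3 * s                          <⟨ ℕ.m<n+m (3 * s) {3} (s≤s z≤n) ⟩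
        3 + 3 * s                      ≡⟨ ℕ.*-suc 3 s ⟨
        3 * suc s                      ≤⟨ 3t≤n ⟩
        n                              ∎)
        where open ℕ.≤-Reasoning

leaf-≡ : ∀ {T} (x y : Leaf T) → proj₁ x ≡ proj₁ y → x ≡ y
leaf-≡ (x , p) (.x , q) refl = cong (x ,_) (ℕ.≤-irrelevant p q)

module Cuts {G : Graph} (D : BranchDecomposition G) where
  open BranchDecomposition D
  open Graph T using (_~_; _~?_)
  open Trees isTree

  μ-injective : ∀ {u v} → μ u ≡ μ v → u ≡ v
  μ-injective {u} {v} e = Bijection.injective leaves
    (leaf-≡ {T} (Bijection.to leaves u) (Bijection.to leaves v) e)

  cut⁺ : ∀ {x y v} → Side x y (μ v) → v ∈ₛ cut (x , y)
  cut⁺ s = ∈-tabulate⁺ ([]=⇒lookup (Walks.∈component⁺ (T ─ᵉ _) s))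

  cut⁻ : ∀ {x y v} → v ∈ₛ cut (x , y) → Side x y (μ v)
  cut⁻ m = Walks.∈component⁻ (T ─ᵉ _) (lookup⇒[]= _ _ (∈-tabulate⁻ m))

  width-≥ : ∀ {κ x y} → x ~ y → κ (cut (x , y)) ≤ width κ
  width-≥ {κ} {x} {y} x~y = lookupAll (xs≤max 0 _)
    (∈-map⁺ (κ ∘ cut) (∈-filter⁺ (λ (v , w) → v ~? w) (∈-cartesianProduct⁺ (∈-allFin x) (∈-allFin y)) x~y))

  width-≤ : ∀ {κ k} → (∀ {x y} → x ~ y → κ (cut (x , y)) ≤ k) → width κ ≤ k
  width-≤ {κ} {k} bound = max≤v⁺ z≤n (All-map⁺ (All-tabulate λ {e} m →
    bound (proj₂ (∈-filter⁻ (λ (v , w) → v ~? w) {xs = cartesianProduct (allFin _) (allFin _)} m))))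

  -- The leaves of the vertices `e i` are marked. The cut is chosen without regard to a cut
  -- function, so it serves for every `κ`.
  balancedCut : ∀ {n s} (e : Fin n → V G) → (∀ {i j} → e i ≡ e j → i ≡ j) → 3 * suc s ≤ n →
    ∃ λ A → (∀ κ → κ A ≤ width κ) ×
      suc s ≤ ∣ ⟪ (λ i → e i ∈ₛ? A) ⟫ ∣ × suc s ≤ ∣ ∁ ⟪ (λ i → e i ∈ₛ? A) ⟫ ∣
  balancedCut e e-inj 3t≤n with balancedEdge isTree degree≤3 (μ ∘ e) (e-inj ∘ μ-injective) 3t≤n
  ... | x , y , x~y , p , q = cut (x , y) , (λ κ → width-≥ {κ} x~y) ,
    ℕ.≤-trans p (p⊆q⇒∣p∣≤∣q∣ to) ,
    ℕ.≤-trans q (p⊆q⇒∣p∣≤∣q∣ λ m → x∉p⇒x∈∁p (x∈∁p⇒x∉p m ∘ from))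
    where
    to : ⟪ side? x y ∘ μ ∘ e ⟫ ⊆ ⟪ (λ i → e i ∈ₛ? cut (x , y)) ⟫
    to m = ∈⟪⟫⁺ (λ i → e i ∈ₛ? cut (x , y)) (cut⁺ (∈⟪⟫⁻ (side? x y ∘ μ ∘ e) m))
    from : ⟪ (λ i → e i ∈ₛ? cut (x , y)) ⟫ ⊆ ⟪ side? x y ∘ μ ∘ e ⟫
    from m = ∈⟪⟫⁺ (side? x y ∘ μ ∘ e) (cut⁻ (∈⟪⟫⁻ (λ i → e i ∈ₛ? cut (x , y)) m))

-- Cliques in tree decompositions

module _ {G : Graph} (D : TreeDecomposition G) where
  open TreeDecomposition D renaming (edges to edgeBag)
  open Graph G using (_~_; irr~)
  open Graph T using () renaming (_~_ to _~ᵀ_)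
  open Trees isTree

  private
    occurrences : V G → Subset (Graph.order T)
    occurrences v = tabulate (λ x → lookup (bag x) v)

    occurs⁺ : ∀ {v x} → v ∈ₛ bag x → x ∈ₛ occurrences v
    occurs⁺ m = ∈-tabulate⁺ ([]=⇒lookup m)

    occurs⁻ : ∀ {v x} → x ∈ₛ occurrences v → v ∈ₛ bag x
    occurs⁻ m = lookup⇒[]= _ _ (∈-tabulate⁻ m)

    Behind : V T → V T → V G → Set
    Behind x z v = ∀ {u} → v ∈ₛ bag u → Side z x u

    -- The nodes whose bags contain `v` induce a connected subgraph that avoids `x`. Walks in it do
    -- not use the edge `xz`, so all these nodes lie behind the same neighbour of `x`.
    behind : ∀ {v x} → ¬ v ∈ₛ bag x → ∃ λ z → x ~ᵀ z × Behind x z v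
    behind {v} {x} v∉x with vertices v
    ... | u , v∈u with branch conn x u
    ...   | inj₁ refl = contradiction v∈u v∉x
    ...   | inj₂ (z , x~z , s) = z , x~z , λ {u′} v∈u′ → s ◅◅
      subst (Walk (T ─ᵉ (z , x)) u) (nth-index O (occurs⁺ v∈u′))
        (subst (λ a → Walk (T ─ᵉ (z , x)) a (nth O (index O (occurs⁺ v∈u′)))) (nth-index O (occurs⁺ v∈u))
          (gmap (nth O) avoid (joined⇒walk (T [ O ]ᵍ) (connected v (index O (occurs⁺ v∈u)) (index O (occurs⁺ v∈u′))))))
      where

      O = occurrences v
      nth≢x : ∀ a → nth O a ≢ x
      nth≢x a e = v∉x (subst (λ w → v ∈ₛ bag w) e (occurs⁻ (nth-∈ O a)))
      avoid : ∀ {a b} → nth O a ~ᵀ nth O b → Graph._~_ (T ─ᵉ (z , x)) (nth O a) (nth O b)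
      avoid {a} {b} e = e , λ { (inj₁ (_ , q)) → nth≢x b q ; (inj₂ (p , _)) → nth≢x a p }

  -- If every bag misses a clique vertex, each node points towards the bags of a vertex it misses.
  -- An edge pointed to from both ends then separates the bags of some `y i` from those of some
  -- `y j`, although these two share a bag.
  cliqueInBag : ∀ {m} (y : Fin (suc m) → V G) → (∀ {i j} → i ≢ j → y i ~ y j) →
                ∃ λ x → ∀ i → y i ∈ₛ bag x
  cliqueInBag y clique with any? (λ x → all? (λ i → y i ∈ₛ? bag x))
  ... | yes p = p
  ... | no ¬p = ⊥-elim (noMutual (mutualEdge next (proj₁ (vertices (y zero)))))
    where
    Q : V T → V T → Set
    Q x z = ∃ λ i → Behind x z (y i)

    next : ∀ x → ∃ λ z → x ~ᵀ z × Q x z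
    next x with ¬∀⟶∃¬ _ _ (λ i → y i ∈ₛ? bag x) (λ all → ¬p (x , all))
    ... | i , ∉x with behind ∉x
    ...   | z , x~z , b = z , x~z , i , b

    common : ∀ i j → ∃ λ u → y i ∈ₛ bag u × y j ∈ₛ bag u
    common i j with i ≟ᶠ j
    ... | yes refl = let u , m = vertices (y i) in u , m , m
    ... | no i≢j   = edgeBag (clique i≢j)

    noMutual : ¬ (∃₂ λ x z → x ~ᵀ z × Q x z × Q z x)
    noMutual (x , z , x~z , (i , b) , (j , b′)) with common i j
    ... | u , mᵢ , mⱼ = side-disjoint x~z (b′ mⱼ) (b mᵢ)

  clique⇒width≥ : ∀ {m} (y : Fin (suc m) → V G) → (∀ {i j} → i ≢ j → y i ~ y j) → m ≤ width
  clique⇒width≥ {m} y clique with cliqueInBag y clique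
  ... | x , all∈ = ℕ.∸-monoˡ-≤ 1 (ℕ.≤-trans (injection⇒≤∣p∣ (bag x) y y-inj all∈)
    (lookupAll (xs≤max 0 (map (λ x → ∣ bag x ∣) (allFin (Graph.order T)))) (∈-map⁺ (λ x → ∣ bag x ∣) (∈-allFin x))))
    where
    y-inj : ∀ {i j} → y i ≡ y j → i ≡ j
    y-inj {i} {j} e with i ≟ᶠ j
    ... | yes p = p
    ... | no ¬p = ⊥-elim (irr~ e (clique ¬p))

-- Cut-rank

sum-zero : ∀ {n} (t : Fin n → Bool) → (∀ i → t i ≡ false) → sum t ≡ false
sum-zero {zero}  t z = refl
sum-zero {suc n} t z rewrite z zero = sum-zero (t ∘ suc) (z ∘ suc)

sum-single : ∀ {n} (t : Fin n → Bool) i → (∀ j → j ≢ i → t j ≡ false) → sum t ≡ t i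
sum-single t zero    z rewrite sum-zero (t ∘ suc) (λ j → z (suc j) λ ()) = xor-identityʳ (t zero)
sum-single t (suc i) z rewrite z zero (λ ()) = sum-single (t ∘ suc) i (λ j j≢i → z (suc j) (j≢i ∘ suc-injective))

-- Equal terms cancel in characteristic 2; this makes two equal rows dependent.
sum-pair : ∀ {n} (t : Fin n → Bool) {i j} → i ≢ j → t i ≡ t j →
           (∀ l → l ≢ i → l ≢ j → t l ≡ false) → sum t ≡ false
sum-pair t {zero}  {zero}  i≢j _ _ = contradiction refl i≢j
sum-pair t {zero}  {suc j} _ e z = trans (cong (t zero xor_) (trans
  (sum-single (t ∘ suc) j (λ l l≢j → z (suc l) (λ ()) (l≢j ∘ suc-injective))) (sym e))) (xor-same (t zero))
sum-pair t {suc i} {zero}  _ e z = trans (cong (t zero xor_) (trans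
  (sum-single (t ∘ suc) i (λ l l≢i → z (suc l) (l≢i ∘ suc-injective) (λ ()))) e)) (xor-same (t zero))
sum-pair t {suc i} {suc j} i≢j e z rewrite z zero (λ ()) (λ ()) =
  sum-pair (t ∘ suc) (i≢j ∘ cong suc) e (λ l l≢i l≢j → z (suc l) (l≢i ∘ suc-injective) (l≢j ∘ suc-injective))

lookup-∉ : ∀ {n} {p : Subset n} {x} → x ∉ₛ p → lookup p x ≡ false
lookup-∉ {p = p} {x} x∉p with lookup p x in e
... | true  = contradiction (lookup⇒[]= x p e) x∉p
... | false = refl

lookup-¬∉ : ∀ {n} {p : Subset n} {x} → lookup p x ≡ false → x ∉ₛ p
lookup-¬∉ e x∈ with trans (sym e) ([]=⇒lookup x∈)
... | ()

does-⇔ : {A B : Set} (a? : Dec A) (b? : Dec B) → (A → B) → (B → A) → does a? ≡ does b?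
does-⇔ (yes a) b? f g = sym (dec-true b? (f a))
does-⇔ (no ¬a) b? f g = sym (dec-false b? (¬a ∘ g))

image : ∀ {k n} → (Fin k → Fin n) → Subset n
image f = ⟪ (λ x → any? λ i → f i ≟ᶠ x) ⟫

module _ {m n} (M : Matrix m n) where

  -- The rows `r` and columns `s` form an identity matrix: among the chosen rows, column `s i` meets
  -- only `r i`, so it reads off the coefficient of that row in a vanishing combination.
  rank-≥ : ∀ {k} (r : Fin k → Fin m) (s : Fin k → Fin n) →
           (∀ i → M (r i) (s i) ≡ true) → (∀ {i j} → i ≢ j → M (r i) (s j) ≡ false) →
           k ≤ rank M
  rank-≥ {k} r s diag off = largest-≥ _ m (S , ∣S∣≡k , independent) (injective⇒≤ r-inj)
    where
    r-inj : ∀ {i j} → r i ≡ r j → i ≡ j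
    r-inj {i} {j} e with i ≟ᶠ j
    ... | yes p = p
    ... | no ¬p with trans (sym (diag j)) (trans (cong (λ x → M x (s j)) (sym e)) (off ¬p))
    ...   | ()

    S : Subset m
    S = image r

    S⁻ : ∀ {x} → x ∈ₛ S → ∃ λ i → r i ≡ x
    S⁻ = ∈⟪⟫⁻ (λ x → any? λ i → r i ≟ᶠ x)

    ∣S∣≡k : ∣ S ∣ ≡ k
    ∣S∣≡k = ℕ.≤-antisym
      (injection⇒∣p∣≤ S (proj₁ ∘ S⁻) (λ x∈ y∈ e → trans (sym (proj₂ (S⁻ x∈))) (trans (cong r e) (proj₂ (S⁻ y∈)))))
      (injection⇒≤∣p∣ S r r-inj (λ i → ∈⟪⟫⁺ (λ x → any? λ i → r i ≟ᶠ x) (i , refl)))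

    independent : LinearlyIndependentRows M S
    independent a a⊆S zeros = ⊆-antisym (λ {x} x∈a → ⊥-elim (x∉a x∈a)) (⊥-elim ∘ ∉⊥)
      where
      x∉a : ∀ {x} → x ∉ₛ a
      x∉a {x} x∈a with S⁻ (a⊆S x∈a)
      ... | i , refl = lookup-¬∉ (trans (sym ai) (trans (sym only) (zeros (s i)))) x∈a
        where
        ai : lookup a (r i) ∧ M (r i) (s i) ≡ lookup a (r i)
        ai = trans (cong (lookup a (r i) ∧_) (diag i)) (∧-identityʳ _)
        only : sum (λ x → lookup a x ∧ M x (s i)) ≡ lookup a (r i) ∧ M (r i) (s i)
        only = sum-single (λ x → lookup a x ∧ M x (s i)) (r i) others
          where
          others : ∀ x → x ≢ r i → lookup a x ∧ M x (s i) ≡ false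
          others x x≢ with x ∈ₛ? a
          ... | no x∉ rewrite lookup-∉ x∉ = refl
          ... | yes x∈ with S⁻ (a⊆S x∈)
          ...   | j , refl = trans (cong (lookup a (r j) ∧_) (off λ { refl → x≢ refl })) (∧-zeroʳ _)

  -- Independent rows are nonzero and pairwise distinct, so at most one of them lies in each of the
  -- `r` classes other than `zero`, which `punchOut` removes.
  rank-≤ : ∀ {r} (class : Fin m → Fin (suc r)) → (∀ i → class i ≡ zero → ∀ j → M i j ≡ false) →
           (∀ i i′ → class i ≡ class i′ → ∀ j → M i j ≡ M i′ j) → rank M ≤ r
  rank-≤ {r} class zeroRow sameRow = largest-≤ _ m bound
    where
    bound : ∀ k → (∃ λ S → ∣ S ∣ ≡ k × LinearlyIndependentRows M S) → k ≤ r
    bound _ (S , refl , indep) =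
      injection⇒∣p∣≤ S (λ x∈ → punchOut (nonzero x∈)) λ x∈ y∈ e →
        inj x∈ y∈ (punchOut-injective (nonzero x∈) (nonzero y∈) e)
      where
      nonzero : ∀ {x} → x ∈ₛ S → zero ≢ class x
      nonzero {x} x∈ e = ∉⊥ (subst (x ∈ₛ_) (indep ⁅ x ⁆ sub λ j → sum-zero _ (λ i → z i j)) (x∈⁅x⁆ x))
        where
        sub : ⁅ x ⁆ ⊆ S
        sub m with refl ← x∈⁅y⁆⇒x≡y _ m = x∈
        z : ∀ i j → lookup ⁅ x ⁆ i ∧ M i j ≡ false
        z i j with i ≟ᶠ x
        ... | yes refl = trans (cong (lookup ⁅ x ⁆ x ∧_) (zeroRow x (sym e) j)) (∧-zeroʳ _)
        ... | no i≢x rewrite lookup-∉ {p = ⁅ x ⁆} (i≢x ∘ x∈⁅y⁆⇒x≡y _) = refl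

      inj : ∀ {x y} → x ∈ₛ S → y ∈ₛ S → class x ≡ class y → x ≡ y
      inj {x} {y} x∈ y∈ e with x ≟ᶠ y
      ... | yes p = p
      ... | no x≢y = ⊥-elim (∉⊥ (subst (x ∈ₛ_) (indep p sub λ j →
                       sum-pair _ x≢y (trans (one x∈p j) (trans (sameRow x y e j) (sym (one y∈p j)))) (z j)) x∈p))
        where
        p = ⁅ x ⁆ ∪ ⁅ y ⁆
        x∈p : x ∈ₛ p
        x∈p = x∈p∪q⁺ (inj₁ (x∈⁅x⁆ x))
        y∈p : y ∈ₛ p
        y∈p = x∈p∪q⁺ (inj₂ (x∈⁅x⁆ y))
        sub : p ⊆ S
        sub m with x∈p∪q⁻ ⁅ x ⁆ ⁅ y ⁆ m
        ... | inj₁ q with refl ← x∈⁅y⁆⇒x≡y _ q = x∈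
        ... | inj₂ q with refl ← x∈⁅y⁆⇒x≡y _ q = y∈
        one : ∀ {i} → i ∈ₛ p → ∀ j → lookup p i ∧ M i j ≡ M i j
        one m j rewrite []=⇒lookup m = refl
        z : ∀ j l → l ≢ x → l ≢ y → lookup p l ∧ M l j ≡ false
        z j l l≢x l≢y
          rewrite lookup-∉ {p = p} {l} (λ m → [ l≢x ∘ x∈⁅y⁆⇒x≡y _ , l≢y ∘ x∈⁅y⁆⇒x≡y _ ]′ (x∈p∪q⁻ ⁅ x ⁆ ⁅ y ⁆ m)) = refl

module _ (G : Graph) where
  open Graph G using (_~_; _~?_)

  cutRank-≥ : ∀ {k} (A : Subset (Graph.order G)) (a b : Fin k → V G) →
              (∀ i → a i ∈ₛ A) → (∀ i → b i ∉ₛ A) →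
              (∀ i → a i ~ b i) → (∀ {i j} → i ≢ j → ¬ a i ~ b j) → k ≤ cutRank G A
  cutRank-≥ A a b a∈ b∉ a~b a≁b = rank-≥ _ (λ i → index A (a∈ i)) (λ i → index (∁ A) (b∈ i))
    (λ i → trans (entry i i) (dec-true (a i ~? b i) (a~b i)))
    (λ {i} {j} i≢j → trans (entry i j) (dec-false (a i ~? b j) (a≁b i≢j)))
    where
    b∈ : ∀ i → b i ∈ₛ ∁ A
    b∈ i = x∉p⇒x∈∁p (b∉ i)
    entry : ∀ i j → does (nth A (index A (a∈ i)) ~? nth (∁ A) (index (∁ A) (b∈ j))) ≡ does (a i ~? b j)
    entry i j = cong₂ (λ u v → does (u ~? v)) (nth-index A (a∈ i)) (nth-index (∁ A) (b∈ j))

  cutRank-≤ : ∀ {r} (A : Subset (Graph.order G)) (class : V G → Fin (suc r)) →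
              (∀ {u w} → u ∈ₛ A → w ∉ₛ A → class u ≡ zero → ¬ u ~ w) →
              (∀ {u v w} → u ∈ₛ A → v ∈ₛ A → w ∉ₛ A → class u ≡ class v → u ~ w → v ~ w) →
              cutRank G A ≤ r
  cutRank-≤ A class zeroClass sameClass = rank-≤ _ (class ∘ nth A)
    (λ i e j → dec-false (_ ~? _) (zeroClass (nth-∈ A i) (out j) e))
    (λ i i′ e j → does-⇔ (_ ~? _) (_ ~? _)
      (sameClass (nth-∈ A i) (nth-∈ A i′) (out j) e) (sameClass (nth-∈ A i′) (nth-∈ A i) (out j) (sym e)))
    where
    out : ∀ j → nth (∁ A) j ∉ₛ A
    out j = x∈∁p⇒x∉p (nth-∈ (∁ A) j)

-- Matchings and splits

allPairs-lookup : ∀ {A : Set} {R : A → A → Set} {xs} → (∀ {x y} → R x y → R y x) → AllPairs R xs →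
                  ∀ {i j} → i ≢ j → R (lookupₗ xs i) (lookupₗ xs j)
allPairs-lookup s (r ∷ rs) {zero}  {zero}  i≢j = contradiction refl i≢j
allPairs-lookup s (r ∷ rs) {zero}  {suc j} _   = lookupAll r (∈-lookup j)
allPairs-lookup s (r ∷ rs) {suc i} {zero}  _   = s (lookupAll r (∈-lookup i))
allPairs-lookup s (r ∷ rs) {suc i} {suc j} i≢j = allPairs-lookup s rs (i≢j ∘ cong suc)

if-elim : {P A : Set} (Q : A → Set) (p? : Dec P) {x y : A} →
          (P → Q x) → (¬ P → Q y) → Q (if does p? then x else y)
if-elim Q (yes p) f g = f p
if-elim Q (no ¬p) f g = g ¬p

module _ (G : Graph) (A : Subset (Graph.order G)) where
  open Graph G using (_~_; sym~)

  maxMatching-≥ : ∀ es → IsMatching G A es → length es ≤ maxMatching G A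
  maxMatching-≥ es m@(_ , disjoint) = largest-≥ _ _ (es , refl , m)
    (subst (_≤ _) (length-map proj₁ es) (unique⇒length≤ (allPairs-map⁺ (mapAllPairs proj₁ disjoint))))

  greedyMatching : ∀ k → (∀ es → length es < k → ∃ λ e → CutEdge G A e × All (Disjoint G A e) es) →
                   k ≤ maxMatching G A
  greedyMatching k extend = let es , eq , m = go k ℕ.≤-refl in subst (_≤ _) eq (maxMatching-≥ es m)
    where
    go : ∀ l → l ≤ k → ∃ λ es → length es ≡ l × IsMatching G A es
    go zero    _   = [] , refl , [] , []
    go (suc l) l<k with go l (ℕ.<⇒≤ l<k)
    ... | es , refl , cutEdges , disjoint with extend es l<k
    ...   | e , c , d = e ∷ es , refl , c ∷ cutEdges , d ∷ disjoint

  -- The easy half of König's theorem: `Z` is a vertex cover of the cut, and disjoint edges need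
  -- different members of it.
  maxMatching-≤ : (Z : List (V G)) → (∀ {a b} → a ∈ₛ A → b ∉ₛ A → a ~ b → a ∈ₗ Z ⊎ b ∈ₗ Z) →
                  maxMatching G A ≤ length Z
  maxMatching-≤ Z cover = largest-≤ _ (Graph.order G) bound
    where
    Meets : V G × V G → Set
    Meets (a , b) = a ∈ₛ A × b ∉ₛ A × ∃ λ z → z ∈ₗ Z × (z ≡ a ⊎ z ≡ b)

    meets : ∀ {e} → CutEdge G A e → Meets e
    meets (a∈ , b∈ , a~b) with x∈∁p⇒x∉p b∈
    ... | b∉ with cover a∈ b∉ a~b
    ...   | inj₁ m = a∈ , b∉ , _ , m , inj₁ refl
    ...   | inj₂ m = a∈ , b∉ , _ , m , inj₂ refl

    position : ∀ {e} → Meets e → Fin (length Z)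
    position (_ , _ , _ , m , _) = ∈⇒index m

    separate : ∀ {e e′} (p : Meets e) (p′ : Meets e′) → Disjoint G A e e′ → position p ≢ position p′
    separate (a∈ , b∉ , _ , m , q) (a∈′ , b∉′ , _ , m′ , q′) (a≢ , b≢) e
      with ∈⇒index-injective m m′ e | q | q′
    ... | refl | inj₁ refl | inj₁ refl = a≢ refl
    -- A vertex cannot be the end in `A` of one edge and the end outside `A` of the other.
    ... | refl | inj₁ refl | inj₂ refl = b∉′ a∈
    ... | refl | inj₂ refl | inj₁ refl = b∉ a∈′
    ... | refl | inj₂ refl | inj₂ refl = b≢ refl

    bound : ∀ k → (∃ λ es → length es ≡ k × IsMatching G A es) → k ≤ length Z
    bound _ (es , refl , cutEdges , disjoint) = injective⇒≤ {f = λ i → position (at i)} inj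
      where
      at : ∀ i → Meets (lookupₗ es i)
      at i = meets (lookupAll cutEdges (∈-lookup i))
      inj : ∀ {i j} → position (at i) ≡ position (at j) → i ≡ j
      inj {i} {j} e with i ≟ᶠ j
      ... | yes p = p
      ... | no i≢j = ⊥-elim (separate (at i) (at j)
              (allPairs-lookup (λ (p , q) → p ∘ sym , q ∘ sym) disjoint i≢j) e)

  splitMatching-≥ : ∀ {k} → ¬ IsSplit G A → k ≤ maxMatching G A → k ≤ splitMatching G A
  splitMatching-≥ {k} ¬split k≤ =
    if-elim (k ≤_) (isSplit? G A) (λ split → contradiction split ¬split) (λ _ → k≤)

  splitMatching-≤ : ∀ {k} → 1 ≤ k → (¬ IsSplit G A → maxMatching G A ≤ k) → splitMatching G A ≤ k
  splitMatching-≤ {k} 1≤k ≤k = if-elim (_≤ k) (isSplit? G A) (λ _ → 1≤k) ≤k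

-- Branch decompositions from binary trees

-- Graphs whose vertices carry structured names, with every edge specified in one direction only.
-- The decomposition trees, the blow-ups and the hosts are all built in this way.
module ArcGraph {A : Set} {n} (enum : A ↔ Fin n) (Arc : A → A → Set)
                (arc? : ∀ a b → Dec (Arc a b)) (loopless : ∀ {a} → ¬ Arc a a) where

  code : A → Fin n
  code = Inverse.to enum

  name : Fin n → A
  name = Inverse.from enum

  name-code : ∀ a → name (code a) ≡ a
  name-code = Inverse.strictlyInverseʳ enum

  code-name : ∀ i → code (name i) ≡ i
  code-name = Inverse.strictlyInverseˡ enum

  code-injective : ∀ {a b} → code a ≡ code b → a ≡ b
  code-injective e = trans (sym (name-code _)) (trans (cong name e) (name-code _))

  name-injective : ∀ {i j} → name i ≡ name j → i ≡ j
  name-injective e = trans (sym (code-name _)) (trans (cong code e) (code-name _))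

  Adj : A → A → Set
  Adj a b = Arc a b ⊎ Arc b a

  graph : Graph
  graph = record
    { order = n
    ; _~_   = λ i j → Adj (name i) (name j)
    ; _~?_  = λ i j → arc? (name i) (name j) ⊎-dec arc? (name j) (name i)
    ; sym~  = λ { (inj₁ e) → inj₂ e ; (inj₂ e) → inj₁ e }
    ; irr~  = λ { refl (inj₁ e) → loopless e ; refl (inj₂ e) → loopless e }
    }

  adj : ∀ {a b} → Adj a b → Graph._~_ graph (code a) (code b)
  adj {a} {b} e rewrite name-code a | name-code b = e

data Tree (A : Set) : Set where
  leaf : A → Tree A
  node : Tree A → Tree A → Tree A

data _∈ᵗ_ {A : Set} (a : A) : Tree A → Set where
  here  : a ∈ᵗ leaf a
  left  : ∀ {l r} → a ∈ᵗ l → a ∈ᵗ node l r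
  right : ∀ {l r} → a ∈ᵗ r → a ∈ᵗ node l r

module _ {A : Set} where

  -- Positions, internal ones included, are the nodes of the decomposition tree; the root becomes a
  -- node of degree 2 unless the tree is a single leaf.
  data Pos : Tree A → Set where
    root  : ∀ {t} → Pos t
    left  : ∀ {l r} → Pos l → Pos (node l r)
    right : ∀ {l r} → Pos r → Pos (node l r)

  sub : ∀ {t} → Pos t → Tree A
  sub {t} root  = t
  sub (left p)  = sub p
  sub (right p) = sub p

  size : Tree A → ℕ
  size (leaf _)   = 1
  size (node l r) = 1 + (size l + size r)

  enumPos : ∀ t → Pos t ↔ Fin (size t)
  enumPos (leaf a) = ↔-sym 1↔⊤ ↔-∘ mk↔ₛ′ (λ _ → tt) (λ _ → root) (λ _ → refl) (λ { root → refl })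
  enumPos (node l r) = ↔-sym +↔⊎ ↔-∘ ((↔-sym 1↔⊤ ⊎-↔ (↔-sym +↔⊎ ↔-∘ (enumPos l ⊎-↔ enumPos r)))
                                    ↔-∘ mk↔ₛ′ to from to∘from from∘to)
    where
    to : Pos (node l r) → ⊤ ⊎ (Pos l ⊎ Pos r)
    to root      = inj₁ tt
    to (left p)  = inj₂ (inj₁ p)
    to (right p) = inj₂ (inj₂ p)
    from : ⊤ ⊎ (Pos l ⊎ Pos r) → Pos (node l r)
    from (inj₁ _)        = root
    from (inj₂ (inj₁ p)) = left p
    from (inj₂ (inj₂ p)) = right p
    to∘from : ∀ x → to (from x) ≡ x
    to∘from (inj₁ _)        = refl
    to∘from (inj₂ (inj₁ _)) = refl
    to∘from (inj₂ (inj₂ _)) = refl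
    from∘to : ∀ x → from (to x) ≡ x
    from∘to root      = refl
    from∘to (left _)  = refl
    from∘to (right _) = refl

  data Child : ∀ {t} → Pos t → Pos t → Set where
    atLeft  : ∀ {l r} → Child {node l r} root (left root)
    atRight : ∀ {l r} → Child {node l r} root (right root)
    left    : ∀ {l r} {p c : Pos l} → Child p c → Child {node l r} (left p) (left c)
    right   : ∀ {l r} {p c : Pos r} → Child p c → Child {node l r} (right p) (right c)

  child? : ∀ {t} (p c : Pos t) → Dec (Child p c)
  child? root root                = no λ ()
  child? root (left root)         = yes atLeft
  child? root (left (left _))     = no λ ()
  child? root (left (right _))    = no λ ()
  child? root (right root)        = yes atRight
  child? root (right (left _))    = no λ ()
  child? root (right (right _))   = no λ ()
  child? (left p) root            = no λ ()
  child? (left p) (left c)        = map′ left (λ { (left e) → e }) (child? p c)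
  child? (left p) (right c)       = no λ ()
  child? (right p) root           = no λ ()
  child? (right p) (left c)       = no λ ()
  child? (right p) (right c)      = map′ right (λ { (right e) → e }) (child? p c)

  child-irr : ∀ {t} {p : Pos t} → ¬ Child p p
  child-irr (left e)  = child-irr e
  child-irr (right e) = child-irr e

  parent-unique : ∀ {t} {p q c : Pos t} → Child p c → Child q c → p ≡ q
  parent-unique atLeft    atLeft    = refl
  parent-unique atRight   atRight   = refl
  parent-unique (left e)  (left f)  = cong left (parent-unique e f)
  parent-unique (right e) (right f) = cong right (parent-unique e f)

  which : ∀ {t} {p c : Pos t} → Child p c → Fin 2
  which atLeft    = zero
  which atRight   = suc zero
  which (left e)  = which e
  which (right e) = which e

  which-injective : ∀ {t} {p c d : Pos t} (e : Child p c) (f : Child p d) → which e ≡ which f → c ≡ d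
  which-injective atLeft    atLeft    _ = refl
  which-injective atRight   atRight   _ = refl
  which-injective (left e)  (left f)  q = cong left (which-injective e f q)
  which-injective (right e) (right f) q = cong right (which-injective e f q)

  -- The order of arguments is: the second position lies in the subtree at the first.
  data Below : ∀ {t} → Pos t → Pos t → Set where
    root  : ∀ {t} {q : Pos t} → Below root q
    left  : ∀ {l r} {p q : Pos l} → Below p q → Below {node l r} (left p) (left q)
    right : ∀ {l r} {p q : Pos r} → Below p q → Below {node l r} (right p) (right q)

  below-refl : ∀ {t} (p : Pos t) → Below p p
  below-refl root      = root
  below-refl (left p)  = left (below-refl p)
  below-refl (right p) = right (below-refl p)

  below? : ∀ {t} (p q : Pos t) → Dec (Below p q)
  below? root q              = yes root
  below? (left p) root       = no λ ()
  below? (left p) (left q)   = map′ left (λ { (left b) → b }) (below? p q)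
  below? (left p) (right q)  = no λ ()
  below? (right p) root      = no λ ()
  below? (right p) (left q)  = no λ ()
  below? (right p) (right q) = map′ right (λ { (right b) → b }) (below? p q)

  below-down : ∀ {t} {a b c : Pos t} → Child a b → Below c a → Below c b
  below-down e         root      = root
  below-down (left e)  (left q)  = left (below-down e q)
  below-down (right e) (right q) = right (below-down e q)

  -- The only edge that leaves the subtree at `c` is the one above `c`. Removing it therefore makes
  -- this subtree one of the two sides.
  below-up : ∀ {t} {a b c : Pos t} → Child a b → Below c b → b ≡ c ⊎ Below c a
  below-up e         root         = inj₂ root
  below-up atLeft    (left root)  = inj₁ refl
  below-up atRight   (right root) = inj₁ refl
  below-up (left e)  (left q)  with below-up e q
  ... | inj₁ refl = inj₁ refl
  ... | inj₂ q′   = inj₂ (left q′)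
  below-up (right e) (right q) with below-up e q
  ... | inj₁ refl = inj₁ refl
  ... | inj₂ q′   = inj₂ (right q′)

  below-parent : ∀ {t} {p c : Pos t} → Child p c → ¬ Below c p
  below-parent (left e)  (left q)  = below-parent e q
  below-parent (right e) (right q) = below-parent e q

  descend : ∀ {t} {c q : Pos t} → Below c q → Star Child c q
  descend {q = root}    root      = ε
  descend {q = left q}  root      = atLeft ◅ gmap left left (descend root)
  descend {q = right q} root      = atRight ◅ gmap right right (descend root)
  descend               (left b)  = gmap left left (descend b)
  descend               (right b) = gmap right right (descend b)

  below-descend : ∀ {t} {a b c : Pos t} → Star Child a b → Below c a → Below c b
  below-descend ε       q = q
  below-descend (e ◅ s) q = below-descend s (below-down e q)

  leafPos : ∀ {a t} → a ∈ᵗ t → Pos t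
  leafPos here      = root
  leafPos (left m)  = left (leafPos m)
  leafPos (right m) = right (leafPos m)

  sub-leafPos : ∀ {a t} (m : a ∈ᵗ t) → sub (leafPos m) ≡ leaf a
  sub-leafPos here      = refl
  sub-leafPos (left m)  = sub-leafPos m
  sub-leafPos (right m) = sub-leafPos m

  leaf-∈ : ∀ {a t} (p : Pos t) → sub p ≡ leaf a → ∃ λ (m : a ∈ᵗ t) → leafPos m ≡ p
  leaf-∈ root refl = here , refl
  leaf-∈ (left p) e with leaf-∈ p e
  ... | m , refl = left m , refl
  leaf-∈ (right p) e with leaf-∈ p e
  ... | m , refl = right m , refl

  leaf-childless : ∀ {a t} {p c : Pos t} → sub p ≡ leaf a → ¬ Child p c
  leaf-childless q (left e)  = leaf-childless q e
  leaf-childless q (right e) = leaf-childless q e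

  leafOrBinary : ∀ {t} (p : Pos t) → (∃ λ a → sub p ≡ leaf a) ⊎ ∃₂ λ c d → Child p c × Child p d × c ≢ d
  leafOrBinary {leaf a}   root = inj₁ (a , refl)
  leafOrBinary {node l r} root = inj₂ (left root , right root , atLeft , atRight , λ ())
  leafOrBinary (left p) with leafOrBinary p
  ... | inj₁ q = inj₁ q
  ... | inj₂ (c , d , e , f , c≢d) = inj₂ (_ , _ , left e , left f , λ { refl → c≢d refl })
  leafOrBinary (right p) with leafOrBinary p
  ... | inj₁ q = inj₁ q
  ... | inj₂ (c , d , e , f , c≢d) = inj₂ (_ , _ , right e , right f , λ { refl → c≢d refl })

  ∈-sub⁺ : ∀ {a t} (c : Pos t) (m : a ∈ᵗ t) → Below c (leafPos m) → a ∈ᵗ sub c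
  ∈-sub⁺ root      m         _         = m
  ∈-sub⁺ (left c)  (left m)  (left b)  = ∈-sub⁺ c m b
  ∈-sub⁺ (right c) (right m) (right b) = ∈-sub⁺ c m b

  ∈-sub⁻ : ∀ {a t} (c : Pos t) → a ∈ᵗ sub c → ∃ λ (m : a ∈ᵗ t) → Below c (leafPos m)
  ∈-sub⁻ root      m = m , root
  ∈-sub⁻ (left c)  m = let m′ , b = ∈-sub⁻ c m in left m′ , left b
  ∈-sub⁻ (right c) m = let m′ , b = ∈-sub⁻ c m in right m′ , right b

module TreeGraph {A : Set} (t : Tree A) where
  open ArcGraph (enumPos t) Child child? child-irr public renaming (graph to treeGraph)

  private
    T = treeGraph
    open Sides T

  module _ {x y} (y→x : Child (name y) (name x)) where

    private
      c = name x

      stay : ∀ {u v} → Graph._~_ (T ─ᵉ (x , y)) u v → Below c (name u) → Below c (name v)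
      stay (inj₁ e , _)   b = below-down e b
      stay (inj₂ e , ¬is) b with below-up e b
      ... | inj₂ b′ = b′
      ... | inj₁ eq with refl ← name-injective eq =
        contradiction (inj₁ (refl , sym (name-injective (parent-unique y→x e)))) ¬is

      stays : ∀ {u v} → Walk (T ─ᵉ (x , y)) u v → Below c (name u) → Below c (name v)
      stays ε       b = b
      stays (e ◅ s) b = stays s (stay e b)

    lowerSide⁻ : ∀ {u} → Side x y u → Below c (name u)
    lowerSide⁻ s = stays s (below-refl c)

    upperSide⁻ : ∀ {u} → Side y x u → ¬ Below c (name u)
    upperSide⁻ s b = below-parent y→x (stays (flip (T ─ᵉ (x , y)) (swap s)) b)

    private
      keep : ∀ {a b} → Child a b → (Below c a × Below c b) ⊎ (¬ Below c a × ¬ Below c b) →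
             Graph._~_ (T ─ᵉ (x , y)) (code a) (code b)
      keep {a} {b} e same = adj (inj₁ e) , λ
        { (inj₁ (p , q)) → clash (at p) (at q) same
        ; (inj₂ (p , q)) → clash (at q) (at p) (swapSame same) }
        where
        at : ∀ {a u} → code a ≡ u → a ≡ name u
        at {a} p = trans (sym (name-code a)) (cong name p)
        clash : ∀ {a b} → a ≡ name x → b ≡ name y →
                ¬ ((Below c a × Below c b) ⊎ (¬ Below c a × ¬ Below c b))
        clash refl refl (inj₁ (_ , below)) = below-parent y→x below
        clash refl refl (inj₂ (¬below , _)) = ¬below (below-refl c)
        swapSame : ∀ {P Q : Set} → (P × Q) ⊎ (¬ P × ¬ Q) → (Q × P) ⊎ (¬ Q × ¬ P)
        swapSame (inj₁ (p , q)) = inj₁ (q , p)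
        swapSame (inj₂ (p , q)) = inj₂ (q , p)

      inside-walk : ∀ {a b} → Star Child a b → Below c a → Walk (T ─ᵉ (x , y)) (code a) (code b)
      inside-walk ε       q = ε
      inside-walk (e ◅ s) q = keep e (inj₁ (q , below-down e q)) ◅ inside-walk s (below-down e q)

      outside-walk : ∀ {a b} → Star Child a b → ¬ Below c b → Walk (T ─ᵉ (x , y)) (code a) (code b)
      outside-walk ε       q = ε
      outside-walk (e ◅ s) q =
        keep e (inj₂ (q ∘ below-descend (e ◅ s) , q ∘ below-descend s)) ◅ outside-walk s q

    lowerSide⁺ : ∀ {u} → Below c (name u) → Side x y u
    lowerSide⁺ {u} b = subst (Walk (T ─ᵉ (x , y)) x) (code-name u)
      (subst (λ v → Walk (T ─ᵉ (x , y)) v (code (name u))) (code-name x) (inside-walk (descend b) (below-refl c)))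

    upperSide⁺ : ∀ {u} → ¬ Below c (name u) → Side y x u
    upperSide⁺ {u} ¬b = swap (subst (Walk (T ─ᵉ (x , y)) y) (code-name u)
      (subst (λ v → Walk (T ─ᵉ (x , y)) v (code (name u))) (code-name y)
        (flip (T ─ᵉ (x , y)) (outside-walk (descend root) (below-parent y→x)) ◅◅ outside-walk (descend root) ¬b)))

  private
    -- Every edge is a bridge, hence on no cycle.
    bridge : ∀ {x y} → Graph._~_ T x y → ¬ Side x y y
    bridge (inj₂ y→x) s = below-parent y→x (lowerSide⁻ y→x s)
    bridge (inj₁ x→y) s = upperSide⁻ x→y s (below-refl _)

  treeGraph-isTree : IsTree T
  treeGraph-isTree = connected , acyclic
    where
    fromRoot : ∀ u → Walk T (code root) u
    fromRoot u = subst (Walk T (code root)) (code-name u) (gmap code (adj ∘ inj₁) (descend root))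

    connected : Connected T
    connected u v = walk⇒joined T (flip T (fromRoot u) ◅◅ fromRoot v)

    -- The part of a cycle after its first edge `xy` returns to `x` without that edge, because each
    -- of its steps starts at a vertex other than `x` and `y`.
    around : ∀ {x y z} zs → All (x ≢_) (z ∷ zs) → All (y ≢_) (z ∷ zs) → Linked (Graph._~_ T) (z ∷ zs ++ [ x ]) →
             Walk (T ─ᵉ (x , y)) z x
    around []       (x≢ ∷ _)  (y≢ ∷ _)  (e ∷ _) =
      (e , λ { (inj₁ (p , _)) → x≢ (sym p) ; (inj₂ (p , _)) → y≢ (sym p) }) ◅ ε
    around (w ∷ zs) (x≢ ∷ xs) (y≢ ∷ ys) (e ∷ l) =
      (e , λ { (inj₁ (p , _)) → x≢ (sym p) ; (inj₂ (p , _)) → y≢ (sym p) }) ◅ around zs xs ys l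

    acyclic : ∀ xs → ¬ IsCycle T xs
    acyclic (x ∷ y ∷ [])     (s≤s () , _)
    acyclic (x ∷ y ∷ z ∷ zs) (_ , (x≢y ∷ x≢) ∷ (y≢ ∷ uq) , x~y ∷ y~z ∷ l) =
      bridge x~y (flip (T ─ᵉ (x , y))
        ((y~z , λ { (inj₁ (p , _)) → x≢y (sym p) ; (inj₂ (_ , q)) → lookupHead x≢ (sym q) })
          ◅ around zs x≢ y≢ l))
      where
      lookupHead : ∀ {P : V T → Set} {z zs} → All P (z ∷ zs) → P z
      lookupHead (p ∷ _) = p

  private
    -- Slot 0 is for the parent, slots 1 and 2 are for the children.
    slot : ∀ {u v} → Graph._~_ T u v → Fin 3
    slot (inj₁ e) = suc (which e)
    slot (inj₂ e) = zero

    slot-injective : ∀ {u v w} (e : Graph._~_ T u v) (f : Graph._~_ T u w) → slot {u} e ≡ slot {u} f → v ≡ w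
    slot-injective (inj₁ e) (inj₁ f) q = name-injective (which-injective e f (suc-injective q))
    slot-injective (inj₂ e) (inj₂ f) q = name-injective (parent-unique e f)

  treeGraph-degree≤3 : ∀ u → Graph.degree T u ≤ 3
  treeGraph-degree≤3 u = injection⇒∣p∣≤ (Graph.N T u) (slot {u} ∘ ∈⟪⟫⁻ (Graph._~?_ T u))
    (λ v∈ w∈ → slot-injective {u} (∈⟪⟫⁻ (Graph._~?_ T u) v∈) (∈⟪⟫⁻ (Graph._~?_ T u) w∈))

  leaf-degree : ∀ {u a} → sub (name u) ≡ leaf a → Graph.degree T u ≤ 1
  leaf-degree {u} q = injection⇒∣p∣≤ (Graph.N T u) (λ _ → zero) λ v∈ w∈ _ →
    same (∈⟪⟫⁻ (Graph._~?_ T u) v∈) (∈⟪⟫⁻ (Graph._~?_ T u) w∈)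
    where
    same : ∀ {v w} → Graph._~_ T u v → Graph._~_ T u w → v ≡ w
    same (inj₁ e) _        = ⊥-elim (leaf-childless q e)
    same (inj₂ _) (inj₁ f) = ⊥-elim (leaf-childless q f)
    same (inj₂ e) (inj₂ f) = name-injective (parent-unique e f)

  -- Keeps internal positions, in particular the root, from counting as a `Leaf`.
  binary-degree : ∀ {u c d} → Child (name u) c → Child (name u) d → c ≢ d → 2 ≤ Graph.degree T u
  binary-degree {u} {c} {d} e f c≢d = injection⇒≤∣p∣ (Graph.N T u) pick pick-inj pick∈
    where
    pick : Fin 2 → V T
    pick zero    = code c
    pick (suc _) = code d
    pick-inj : ∀ {i j} → pick i ≡ pick j → i ≡ j
    pick-inj {zero}     {zero}     _ = refl
    pick-inj {zero}     {suc zero} q = contradiction (code-injective q) c≢d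
    pick-inj {suc zero} {zero}     q = contradiction (sym (code-injective q)) c≢d
    pick-inj {suc zero} {suc zero} _ = refl
    nb : ∀ {c} → Child (name u) c → code c ∈ₛ Graph.N T u
    nb {c} e = ∈⟪⟫⁺ (Graph._~?_ T u) (inj₁ (subst (Child (name u)) (sym (name-code c)) e))
    pick∈ : ∀ i → pick i ∈ₛ Graph.N T u
    pick∈ zero    = nb e
    pick∈ (suc _) = nb f

module _ {G : Graph} (t : Tree (V G)) (complete : ∀ v → v ∈ᵗ t) (unique : ∀ {v} (m m′ : v ∈ᵗ t) → m ≡ m′) where

  open TreeGraph t

  private
    T = treeGraph

    toLeaf : V G → Leaf T
    toLeaf v = code (leafPos (complete v)) ,
      leaf-degree (trans (cong sub (name-code (leafPos (complete v)))) (sub-leafPos (complete v)))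

    leaf-inj : ∀ {u v : V G} → leaf u ≡ leaf v → u ≡ v
    leaf-inj refl = refl

    toLeaf-injective : ∀ {u v} → toLeaf u ≡ toLeaf v → u ≡ v
    toLeaf-injective {u} {v} e = leaf-inj (trans (sym (sub-leafPos (complete u)))
      (trans (cong sub (code-injective (cong proj₁ e))) (sub-leafPos (complete v))))

    toLeaf-surjective : (x : Leaf T) → ∃ λ v → ∀ {w} → w ≡ v → toLeaf w ≡ x
    toLeaf-surjective x@(u , d) with leafOrBinary (name u)
    ... | inj₂ (_ , _ , e , f , c≢d) = contradiction (ℕ.≤-trans (binary-degree {u} e f c≢d) d) λ { (s≤s ()) }
    ... | inj₁ (a , q) with leaf-∈ (name u) q
    ...   | m , e = a , λ { refl → leaf-≡ {T} _ x
      (trans (cong code (trans (cong leafPos (unique (complete a) m)) e)) (code-name u)) }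

  treeDecomposition : BranchDecomposition G
  treeDecomposition = record
    { T = T ; isTree = treeGraph-isTree ; degree≤3 = treeGraph-degree≤3
    ; leaves = mk⤖ (toLeaf-injective , toLeaf-surjective) }

  private
    D = treeDecomposition
    open Cuts D

    below⇔∈ : ∀ c v → (Below c (name (BranchDecomposition.μ D v)) → v ∈ᵗ sub c) ×
                      (v ∈ᵗ sub c → Below c (name (BranchDecomposition.μ D v)))
    below⇔∈ c v rewrite name-code (leafPos (complete v)) =
      ∈-sub⁺ c (complete v) , λ m → let m′ , b = ∈-sub⁻ c m in subst (Below c ∘ leafPos) (unique m′ (complete v)) b

  -- Every edge is the edge above some position `c`, so its two sides are the leaf set of the
  -- subtree at `c` and the complement. `A` enters through two inclusions, which spares computing
  -- the leaf set as a `Subset`.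
  treeWidth-≤ : ∀ {κ k} →
    (∀ (c : Pos t) A → (∀ {v} → v ∈ₛ A → v ∈ᵗ sub c) → (∀ {v} → v ∈ᵗ sub c → v ∈ₛ A) →
       κ A ≤ k × κ (∁ A) ≤ k) →
    BranchDecomposition.width D κ ≤ k
  treeWidth-≤ {κ} {k} bound = width-≤ {κ} edge
    where
    open BranchDecomposition D using (cut; μ)

    edge : ∀ {x y} → Graph._~_ T x y → κ (cut (x , y)) ≤ k
    edge {x} {y} (inj₂ y→x) = proj₁ (bound (name x) _
      (λ m → proj₁ (below⇔∈ _ _) (lowerSide⁻ y→x (cut⁻ m)))
      (λ m → cut⁺ (lowerSide⁺ y→x (proj₂ (below⇔∈ _ _) m))))
    -- Here `cut` takes the upper side, so the leaf set of the subtree is its complement.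
    edge {x} {y} (inj₁ x→y) = subst (λ A → κ A ≤ k) (⊆-antisym to from)
      (proj₂ (bound (name y) (∁ (cut (x , y))) lower⁻ lower⁺))
      where
      lower⁻ : ∀ {v} → v ∈ₛ ∁ (cut (x , y)) → v ∈ᵗ sub (name y)
      lower⁻ {v} m with below? (name y) (name (μ v))
      ... | yes b = proj₁ (below⇔∈ _ _) b
      ... | no ¬b = contradiction (cut⁺ (upperSide⁺ x→y ¬b)) (x∈∁p⇒x∉p m)
      lower⁺ : ∀ {v} → v ∈ᵗ sub (name y) → v ∈ₛ ∁ (cut (x , y))
      lower⁺ m = x∉p⇒x∈∁p λ m′ → upperSide⁻ x→y (cut⁻ m′) (proj₂ (below⇔∈ _ _) m)
      to : ∁ (∁ (cut (x , y))) ⊆ cut (x , y)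
      to m = x∉∁p⇒x∈p (x∈∁p⇒x∉p m)
      from : cut (x , y) ⊆ ∁ (∁ (cut (x , y)))
      from m = x∉p⇒x∈∁p λ m′ → x∈∁p⇒x∉p m′ m

-- Caterpillars and linear layouts.

module _ {A : Set} where

  caterpillar : ∀ {n} → (Fin (suc n) → Tree A) → Tree A
  caterpillar {zero}  f = f zero
  caterpillar {suc n} f = node (f zero) (caterpillar (f ∘ suc))

  ∈-caterpillar⁺ : ∀ {n} (f : Fin (suc n) → Tree A) {a} i → a ∈ᵗ f i → a ∈ᵗ caterpillar f
  ∈-caterpillar⁺ {zero}  f zero    m = m
  ∈-caterpillar⁺ {suc n} f zero    m = left m
  ∈-caterpillar⁺ {suc n} f (suc i) m = right (∈-caterpillar⁺ (f ∘ suc) i m)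

  ∈-caterpillar⁻ : ∀ {n} (f : Fin (suc n) → Tree A) {a} → a ∈ᵗ caterpillar f → ∃ λ i → a ∈ᵗ f i
  ∈-caterpillar⁻ {zero}  f m         = zero , m
  ∈-caterpillar⁻ {suc n} f (left m)  = zero , m
  ∈-caterpillar⁻ {suc n} f (right m) = let i , m′ = ∈-caterpillar⁻ (f ∘ suc) m in suc i , m′

  caterpillar-unique : ∀ {n} (f : Fin (suc n) → Tree A) {a} →
    (∀ i (m m′ : a ∈ᵗ f i) → m ≡ m′) → (∀ {i j} → a ∈ᵗ f i → a ∈ᵗ f j → i ≡ j) →
    (m m′ : a ∈ᵗ caterpillar f) → m ≡ m′
  caterpillar-unique {zero}  f u d m         m′         = u zero m m′
  caterpillar-unique {suc n} f u d (left m)  (left m′)  = cong left (u zero m m′)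
  caterpillar-unique {suc n} f u d (left m)  (right m′)
    with () ← d {zero} {suc _} m (proj₂ (∈-caterpillar⁻ (f ∘ suc) m′))
  caterpillar-unique {suc n} f u d (right m) (left m′)
    with () ← d {zero} {suc _} m′ (proj₂ (∈-caterpillar⁻ (f ∘ suc) m))
  caterpillar-unique {suc n} f u d (right m) (right m′) =
    cong right (caterpillar-unique (f ∘ suc) (u ∘ suc) (λ p q → suc-injective (d p q)) m m′)

  -- A position lies inside one of the attached trees or on the spine, and the subtree at a spine
  -- position comprises the attached trees from some index on.
  caterpillar-sub : ∀ {n} (f : Fin (suc n) → Tree A) (p : Pos (caterpillar f)) →
    (∃₂ λ i (q : Pos (f i)) → sub p ≡ sub q) ⊎
    (∃ λ (j : Fin (suc n)) → (∀ {a} → a ∈ᵗ sub p → ∃ λ i → j ≤ᶠ i × a ∈ᵗ f i) ×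
             (∀ {a i} → j ≤ᶠ i → a ∈ᵗ f i → a ∈ᵗ sub p))
  caterpillar-sub {zero}  f p        = inj₁ (zero , p , refl)
  caterpillar-sub {suc n} f root     =
    inj₂ (zero , (λ m → let i , m′ = ∈-caterpillar⁻ f m in i , z≤n , m′) , λ _ m → ∈-caterpillar⁺ f _ m)
  caterpillar-sub {suc n} f (left q) = inj₁ (zero , q , refl)
  caterpillar-sub {suc n} f (right p) with caterpillar-sub (f ∘ suc) p
  ... | inj₁ (i , q , e) = inj₁ (suc i , q , e)
  ... | inj₂ (j , suffix⁻ , suffix⁺) = inj₂
    ( suc j
    , (λ m → let i , j≤i , m′ = suffix⁻ m in suc i , s≤s j≤i , m′)
    , λ { {i = suc i} (s≤s j≤i) m → suffix⁺ j≤i m } )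

leaf-∈⁻ : ∀ {A : Set} {a b : A} → a ∈ᵗ leaf b → a ≡ b
leaf-∈⁻ here = refl

leaf-unique : ∀ {A : Set} {a b : A} (m m′ : a ∈ᵗ leaf b) → m ≡ m′
leaf-unique here here = refl

-- The argument witnesses that `n` is positive, as a `Tree` has at least one leaf.
linear : ∀ {n} → Fin n → Tree (Fin n)
linear {suc n} _ = caterpillar leaf

linear-complete : ∀ {n} (o v : Fin n) → v ∈ᵗ linear o
linear-complete {suc n} _ v = ∈-caterpillar⁺ leaf v here

linear-unique : ∀ {n} (o : Fin n) {v} (m m′ : v ∈ᵗ linear o) → m ≡ m′
linear-unique {suc n} _ = caterpillar-unique leaf (λ _ → leaf-unique)
  (λ p q → trans (sym (leaf-∈⁻ p)) (leaf-∈⁻ q))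

linear-sub : ∀ {n} (o : Fin n) (p : Pos (linear o)) →
  (∃ λ i → sub p ≡ leaf i) ⊎ (∃ λ (j : Fin n) → ∀ {v} → (v ∈ᵗ sub p → j ≤ᶠ v) × (j ≤ᶠ v → v ∈ᵗ sub p))
linear-sub {suc n} _ p with caterpillar-sub leaf p
... | inj₁ (i , root , e) = inj₁ (i , e)
... | inj₂ (j , suffix⁻ , suffix⁺) = inj₂ (j , λ {v} →
  (λ m → let i , j≤i , m′ = suffix⁻ m in subst (j ≤ᶠ_) (sym (leaf-∈⁻ m′)) j≤i) , λ j≤v → suffix⁺ j≤v here)

-- Blow-ups of the 5-cycle

-- Unlike the library's all?, this one can be evaluated on the checks below.
every? : ∀ {n} {P : Fin n → Set} → (∀ i → Dec (P i)) → Dec (∀ i → P i)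
every? {zero}  P? = yes λ ()
every? {suc n} P? = map′ (λ { (p , ps) zero → p ; (p , ps) (suc i) → ps i }) (λ f → f zero , f ∘ suc)
                         (P? zero ×-dec every? (P? ∘ suc))

next : Fin 5 → Fin 5
next 0F = 1F
next 1F = 2F
next 2F = 3F
next 3F = 4F
next 4F = 0F

C₅ : Fin 5 → Fin 5 → Set
C₅ p q = next p ≡ q ⊎ next q ≡ p

C₅? : ∀ p q → Dec (C₅ p q)
C₅? p q = (next p ≟ᶠ q) ⊎-dec (next q ≟ᶠ p)

abstract
  -- Also for p = q, where any neighbour serves as `s`. It supplies the short paths across a cut in
  -- `matching-≥`.
  C₅-diameter : ∀ p q → C₅ p q ⊎ ∃ λ s → C₅ p s × C₅ s q
  C₅-diameter = toWitness {a? = every? λ p → every? λ q → C₅? p q ⊎-dec any? λ s → C₅? p s ×-dec C₅? s q} _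

-- Row j classifies the vertices p ≥ j (p ≤ j) of C₅ by their neighbourhoods in
-- the vertices q ≤ j (q ≥ j); class 0 has no neighbours there.
upperClass lowerClass : Vec (Vec (Fin 4) 5) 5
upperClass = (0F ∷ 1F ∷ 0F ∷ 0F ∷ 1F ∷ [])
           ∷ (0F ∷ 1F ∷ 2F ∷ 0F ∷ 1F ∷ [])
           ∷ (0F ∷ 0F ∷ 1F ∷ 2F ∷ 3F ∷ [])
           ∷ (0F ∷ 0F ∷ 0F ∷ 1F ∷ 2F ∷ [])
           ∷ (0F ∷ 0F ∷ 0F ∷ 0F ∷ 1F ∷ [])
           ∷ []
lowerClass = (1F ∷ 0F ∷ 0F ∷ 0F ∷ 0F ∷ [])
           ∷ (1F ∷ 2F ∷ 0F ∷ 0F ∷ 0F ∷ [])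
           ∷ (1F ∷ 2F ∷ 3F ∷ 0F ∷ 0F ∷ [])
           ∷ (1F ∷ 0F ∷ 2F ∷ 1F ∷ 0F ∷ [])
           ∷ (1F ∷ 0F ∷ 0F ∷ 1F ∷ 0F ∷ [])
           ∷ []

-- `j` is the bag in which the linear layout is cut. Its vertices may lie on both sides, so `p` and
-- `q` both range over `j` as well.
Classifies : Vec (Vec (Fin 4) 5) 5 → (Fin 5 → Fin 5 → Set) → Set
Classifies table _≼_ = ∀ j p p′ q → j ≼ p → j ≼ p′ → q ≼ j →
  (class j p ≡ zero → ¬ C₅ p q) × (class j p ≡ class j p′ → C₅ p q → C₅ p′ q)
  where
  class : Fin 5 → Fin 5 → Fin 4
  class j p = lookup (lookup table j) p

classifies? : ∀ table {_≼_} → (∀ i j → Dec (i ≼ j)) → Dec (Classifies table _≼_)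
classifies? table _≼?_ = every? λ j → every? λ p → every? λ p′ → every? λ q →
  (j ≼? p) →-dec ((j ≼? p′) →-dec ((q ≼? j) →-dec
    (((_ ≟ᶠ _) →-dec ¬? (C₅? p q)) ×-dec ((_ ≟ᶠ _) →-dec (C₅? p q →-dec C₅? p′ q)))))

abstract
  upper-classifies : Classifies upperClass _≤ᶠ_
  upper-classifies = toWitness {a? = classifies? upperClass _≤?_} _

  lower-classifies : Classifies lowerClass (λ i j → j ≤ᶠ i)
  lower-classifies = toWitness {a? = classifies? lowerClass (λ i j → j ≤? i)} _

-- Classifies the vertices outside a single leaf by their adjacency to it.
indicator : {P : Set} → Dec P → Fin 4
indicator p? = if does p? then 1F else 0F

indicator-zero : {P : Set} (p? : Dec P) → indicator p? ≡ zero → ¬ P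
indicator-zero (no ¬p) _ = ¬p

indicator-≡ : {P Q : Set} (p? : Dec P) (q? : Dec Q) → indicator p? ≡ indicator q? → P → Q
indicator-≡ (no ¬p) _       _ p = contradiction p ¬p
indicator-≡ (yes _) (yes q) _ _ = q

-- Blow-ups of the 5-cycle with bags of arbitrary, possibly zero, size and with vertices numbered
-- bag by bag. Free bag sizes make the notion hereditary.
record Bagged (G : Graph) : Set where
  open Graph G using (_~_)
  field
    bag      : V G → Fin 5
    bag-mono : ∀ {u v} → u ≤ᶠ v → bag u ≤ᶠ bag v
    adj⁺     : ∀ {u v} → C₅ (bag u) (bag v) → u ~ v
    adj⁻     : ∀ {u v} → u ~ v → C₅ (bag u) (bag v)

induced-bagged : ∀ {G} → Bagged G → ∀ X → Bagged (G [ X ]ᵍ)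
induced-bagged b X = record
  { bag = bag ∘ nth X ; bag-mono = λ u≤v → bag-mono (nth-mono X u≤v) ; adj⁺ = adj⁺ ; adj⁻ = adj⁻ }
  where open Bagged b

module _ {G : Graph} (bagged : Bagged G) where
  open Graph G using (_~_)
  open Bagged bagged

  -- A cut along the spine of the linear layout puts bags from `j` on against bags up to `j`, where
  -- `j` is the bag of the first vertex of the suffix. The tables show at most three kinds of
  -- nonzero rows.
  bagged-rankWidth≤3 : V G → min rankWidth G ≤ 3
  bagged-rankWidth≤3 o =
    BranchDecomposition.width D (cutRank G) , (D , refl) ,
    treeWidth-≤ {G} (linear o) (linear-complete o) (linear-unique o) {cutRank G} bound
    where
    D = treeDecomposition {G} (linear o) (linear-complete o) (linear-unique o)

    bound : ∀ (c : Pos (linear o)) A → (∀ {v} → v ∈ₛ A → v ∈ᵗ sub c) → (∀ {v} → v ∈ᵗ sub c → v ∈ₛ A) →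
            cutRank G A ≤ 3 × cutRank G (∁ A) ≤ 3
    bound c A A⊆ ⊆A with linear-sub o c
    ... | inj₁ (i , e) =
      -- The only vertex in `A` is `i`, so one nonzero class suffices.
      cutRank-≤ G A (λ _ → 1F) (λ _ _ ()) (λ u∈ v∈ _ _ → subst (_~ _) (trans (single u∈) (sym (single v∈)))) ,
      cutRank-≤ G (∁ A) class
        (λ {u} {w} _ w∉ e u~w → zeroClass u e (subst (u ~_) (single (x∉∁p⇒x∈p w∉)) u~w))
        (λ {u} {v} {w} _ _ w∉ e u~w → subst (v ~_) (sym (single (x∉∁p⇒x∈p w∉)))
           (sameClass u v e (subst (u ~_) (single (x∉∁p⇒x∈p w∉)) u~w)))
      where
      single : ∀ {v} → v ∈ₛ A → v ≡ i
      single {v} v∈ = leaf-∈⁻ (subst (v ∈ᵗ_) e (A⊆ v∈))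
      class : V G → Fin 4
      class u = indicator (C₅? (bag u) (bag i))
      zeroClass : ∀ u → class u ≡ zero → ¬ u ~ i
      zeroClass u e = indicator-zero (C₅? (bag u) (bag i)) e ∘ adj⁻
      sameClass : ∀ u v → class u ≡ class v → u ~ i → v ~ i
      sameClass u v e = adj⁺ ∘ indicator-≡ (C₅? (bag u) (bag i)) (C₅? (bag v) (bag i)) e ∘ adj⁻
    ... | inj₂ (s , suffix) =
      cutRank-≤ G A (λ u → lookup (lookup upperClass j) (bag u))
        (λ {u} {w} u∈ w∉ e u~w →
          proj₁ (upper-classifies j (bag u) (bag u) (bag w) (above u∈) (above u∈) (below w∉)) e (adj⁻ u~w))
        (λ {u} {v} {w} u∈ v∈ w∉ e u~w →
          adj⁺ (proj₂ (upper-classifies j (bag u) (bag v) (bag w) (above u∈) (above v∈) (below w∉)) e (adj⁻ u~w))) ,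
      cutRank-≤ G (∁ A) (λ u → lookup (lookup lowerClass j) (bag u))
        (λ {u} {w} u∈ w∉ e u~w →
          proj₁ (lower-classifies j (bag u) (bag u) (bag w) (below′ u∈) (below′ u∈) (above′ w∉)) e (adj⁻ u~w))
        (λ {u} {v} {w} u∈ v∈ w∉ e u~w →
          adj⁺ (proj₂ (lower-classifies j (bag u) (bag v) (bag w) (below′ u∈) (below′ v∈) (above′ w∉)) e (adj⁻ u~w)))
      where
      j = bag s
      above : ∀ {v} → v ∈ₛ A → j ≤ᶠ bag v
      above v∈ = bag-mono (proj₁ suffix (A⊆ v∈))
      below : ∀ {v} → v ∉ₛ A → bag v ≤ᶠ j
      below v∉ = bag-mono (ℕ.≰⇒≥ (v∉ ∘ ⊆A ∘ proj₂ suffix))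
      above′ : ∀ {v} → v ∉ₛ ∁ A → j ≤ᶠ bag v
      above′ = above ∘ x∉∁p⇒x∈p
      below′ : ∀ {v} → v ∈ₛ ∁ A → bag v ≤ᶠ j
      below′ = below ∘ x∈∁p⇒x∉p

min-≤-trans : ∀ {W k l} → min W ≤ k → k ≤ l → min W ≤ l
min-≤-trans (w , p , w≤k) k≤l = w , p , ℕ.≤-trans w≤k k≤l

-- A component of `G [ X ]ᵍ` is again bagged, and it is nonempty because it contains `u`.
bagged-torso : ∀ {G c} → Bagged G → 3 ≤ c → ∀ X → IsTorso c G X
bagged-torso {G} bagged 3≤c X u = min-≤-trans
  (bagged-rankWidth≤3 (induced-bagged (induced-bagged bagged X) C)
    (index C {u} (Walks.∈component⁺ (G [ X ]ᵍ) {u} {u} ε))) 3≤c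
  where
  C = component (G [ X ]ᵍ) u

-- Two vertices of `P` with neighbours in `Q`, but with different ones: the obstruction to a split.
Separates : Subset 5 → Subset 5 → Set
Separates P Q = (∃ λ p → p ∈ₛ P × ∃ λ p′ → p′ ∈ₛ P × ∃ λ q → q ∈ₛ Q × ∃ λ q′ → q′ ∈ₛ Q ×
  C₅ p q × C₅ p′ q′ × ¬ C₅ p q′)

Several : Subset 5 → Set
Several P = ∃ λ p → p ∈ₛ P × ∃ λ p′ → p′ ∈ₛ P × p ≢ p′

abstract
  -- `P` and `Q` may overlap, since a bag can meet both sides of a cut. For disjoint sets this says
  -- that the 5-cycle has no split.
  C₅-prime : ∀ P Q → (∀ j → j ∈ₛ P ⊎ j ∈ₛ Q) → Several P → Several Q → Separates P Q
  C₅-prime = toWitness {a? = searchAllSubsets λ P → searchAllSubsets λ Q →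
    (every? λ j → (j ∈ₛ? P) ⊎-dec (j ∈ₛ? Q)) →-dec (several? P →-dec (several? Q →-dec
    (any? λ p → (p ∈ₛ? P) ×-dec any? λ p′ → (p′ ∈ₛ? P) ×-dec
    any? λ q → (q ∈ₛ? Q) ×-dec any? λ q′ → (q′ ∈ₛ? Q) ×-dec
      C₅? p q ×-dec C₅? p′ q′ ×-dec ¬? (C₅? p q′))))} _
    where
    several? : ∀ P → Dec (Several P)
    several? P = any? λ p → (p ∈ₛ? P) ×-dec any? λ p′ → (p′ ∈ₛ? P) ×-dec ¬? (p ≟ᶠ p′)

next-irr : ∀ p → next p ≢ p
next-irr (suc zero) ()
next-irr (suc (suc zero)) ()
next-irr (suc (suc (suc zero))) ()
next-irr (suc (suc (suc (suc zero)))) ()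

escape : ∀ {n} (p : Subset n) (Z : List (Fin n)) → length Z < ∣ p ∣ → ∃ λ x → x ∈ₛ p × ¬ x ∈ₗ Z
escape p Z Z<p with any? (λ x → (x ∈ₛ? p) ×-dec ¬? (member? _≟ᶠ_ x Z))
... | yes r = r
... | no ¬r = contradiction
  (injection⇒∣p∣≤ p (∈⇒index ∘ inZ) (λ x∈ y∈ → ∈⇒index-injective (inZ x∈) (inZ y∈))) (ℕ.<⇒≱ Z<p)
  where
  inZ : ∀ {x} → x ∈ₛ p → x ∈ₗ Z
  inZ {x} x∈ = decidable-stable (member? _≟ᶠ_ x Z) λ x∉ → ¬r (x , x∈ , x∉)

-- `place` puts at least `n` vertices into every bag, and `slot` allows at most `n`.
record Blowup (n : ℕ) (G : Graph) : Set where
  field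
    bagged   : Bagged G
    place    : Fin 5 → Fin n → V G
    slot     : V G → Fin n
    5n≤order : 5 * n ≤ Graph.order G
  open Bagged bagged public
  field
    bag-place       : ∀ j x → bag (place j x) ≡ j
    place-injective : ∀ {j x y} → place j x ≡ place j y → x ≡ y
    slot-injective  : ∀ {u v} → bag u ≡ bag v → slot u ≡ slot v → u ≡ v

blowup : ∀ n → ∃ (Blowup n)
blowup n = graph , record
  { bagged          = record { bag = bag ; bag-mono = bag-mono ; adj⁺ = id ; adj⁻ = id }
  ; place           = λ j x → code (j , x)
  ; slot            = λ u → proj₂ (name u)
  ; 5n≤order        = ℕ.≤-refl
  ; bag-place       = λ j x → cong proj₁ (name-code (j , x))
  ; place-injective = λ {j} {x} {y} e → cong proj₂ (code-injective {j , x} {j , y} e)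
  ; slot-injective  = λ p q → name-injective (cong₂ _,_ p q)
  }
  where
  open ArcGraph {Fin 5 × Fin n} (↔-sym *↔×) (λ a b → next (proj₁ a) ≡ proj₁ b)
    (λ a b → next (proj₁ a) ≟ᶠ proj₁ b) (λ {a} → next-irr (proj₁ a))

  bag : V graph → Fin 5
  bag u = proj₁ (name u)

  -- `combine` numbers the pairs lexicographically, with the bag as first component.
  bag-mono : ∀ {u v} → u ≤ᶠ v → bag u ≤ᶠ bag v
  bag-mono {u} {v} u≤v with ℕ.≤-<-connex (toℕ (bag u)) (toℕ (bag v))
  ... | inj₁ p = p
  ... | inj₂ p = contradiction u≤v (ℕ.<⇒≱ (subst₂ _<ᶠ_ (code-name v) (code-name u)
                   (combine-monoˡ-< (proj₂ (name v)) (proj₂ (name u)) p)))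

module _ {n G} (G-blowup : Blowup n G) where
  open Blowup G-blowup
  open Graph G using (_~_; _~?_; N)

  -- Everything is collapsed. The empty graph that remains is decomposed by the empty tree, whose
  -- width is 0 by the default of `max`.
  𝓡-treewidth-zero : ∀ {c} → 3 ≤ c → min 𝓡-treewidth c G ≡ 0
  𝓡-treewidth-zero 3≤c = (full , bagged-torso bagged 3≤c full , (D , refl) , λ _ _ → z≤n) , λ _ _ → z≤n
    where
    ∄ : ¬ V (G ∘ᵍ full)
    ∄ v = x∈∁p⇒x∉p (nth-∈ (∁ (full {Graph.order G})) v) ∈⊤
    empty : Graph
    empty = record { order = 0 ; _~_ = λ _ _ → ⊥ ; _~?_ = λ () ; sym~ = λ () ; irr~ = λ _ () }
    D : TreeDecomposition (G ∘ᵍ full)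
    D = record
      { T = empty ; isTree = (λ ()) , (λ { (() ∷ _) }) ; bag = λ ()
      ; vertices = λ v → ⊥-elim (∄ v) ; edges = λ {u} → ⊥-elim (∄ u) ; connected = λ v → ⊥-elim (∄ v) }

  bagsOf : Subset (Graph.order G) → Subset 5
  bagsOf A = ⟪ (λ j → any? λ u → (u ∈ₛ? A) ×-dec (bag u ≟ᶠ j)) ⟫

  bagsOf⁻ : ∀ {A j} → j ∈ₛ bagsOf A → ∃ λ u → u ∈ₛ A × bag u ≡ j
  bagsOf⁻ {A} = ∈⟪⟫⁻ (λ j → any? λ u → (u ∈ₛ? A) ×-dec (bag u ≟ᶠ j))

  bagsOf⁺ : ∀ {A u} → u ∈ₛ A → bag u ∈ₛ bagsOf A
  bagsOf⁺ {A} {u} u∈ = ∈⟪⟫⁺ (λ j → any? λ u → (u ∈ₛ? A) ×-dec (bag u ≟ᶠ j)) (u , u∈ , refl)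

  -- One bag has at most `n` vertices.
  several : ∀ A → suc n ≤ ∣ A ∣ → Several (bagsOf A)
  several A n<A with any? (λ u → any? λ v → (u ∈ₛ? A) ×-dec (v ∈ₛ? A) ×-dec ¬? (bag u ≟ᶠ bag v))
  ... | yes (u , v , u∈ , v∈ , u≢v) = bag u , bagsOf⁺ u∈ , bag v , bagsOf⁺ v∈ , u≢v
  ... | no ¬two = contradiction (injection⇒∣p∣≤ A (λ {u} _ → slot u) inj) (ℕ.<⇒≱ n<A)
    where
    inj : ∀ {u v} → u ∈ₛ A → v ∈ₛ A → slot u ≡ slot v → u ≡ v
    inj {u} {v} u∈ v∈ e = slot-injective
      (decidable-stable (bag u ≟ᶠ bag v) λ u≢v → ¬two (u , v , u∈ , v∈ , u≢v)) e

  module _ (A : Subset (Graph.order G)) (n<A : suc n ≤ ∣ A ∣) (n<∁A : suc n ≤ ∣ ∁ A ∣) where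

    private
      crossing : ∀ {v v′ w w′} → v ∈ₛ A → v′ ∈ₛ A → w ∈ₛ ∁ A → w′ ∈ₛ ∁ A →
                 v ~ w → v′ ~ w′ → ¬ v ~ w′ → ¬ IsSplit G A
      crossing {v} {v′} {w} {w′} v∈ v′∈ w∈ w′∈ v~w v′~w′ v≁w′ (_ , _ , same) =
        v≁w′ (∈⟪⟫⁻ (v ~?_) (proj₁ (x∈p∩q⁻ (N v) (∁ A)
          (subst (w′ ∈ₛ_) (sym (same v v∈ v′ v′∈ (w , outer {v} v~w w∈) (w′ , outer v′~w′ w′∈))) (outer v′~w′ w′∈)))))
        where
        outer : ∀ {v w} → v ~ w → w ∈ₛ ∁ A → w ∈ₛ (N v ∩ ∁ A)
        outer {v} v~w w∈ = x∈p∩q⁺ (∈⟪⟫⁺ (v ~?_) v~w , w∈)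

    -- The argument exhibits a vertex in each bag, so every bag meets `A` or its complement. As both
    -- meet several bags, `C₅-prime` gives the obstruction, and choosing vertices in the bags lifts
    -- it to `G`.
    notSplit : Fin n → ¬ IsSplit G A
    notSplit x =
      let p , p∈ , p′ , p′∈ , q , q∈ , q′ , q′∈ , pq , p′q′ , ¬pq′ =
            C₅-prime (bagsOf A) (bagsOf (∁ A)) cover (several A n<A) (several (∁ A) n<∁A)
          v , v∈ , v≡ = bagsOf⁻ {A} p∈
          v′ , v′∈ , v′≡ = bagsOf⁻ {A} p′∈
          w , w∈ , w≡ = bagsOf⁻ {∁ A} q∈
          w′ , w′∈ , w′≡ = bagsOf⁻ {∁ A} q′∈
      in crossing v∈ v′∈ w∈ w′∈
           (adj⁺ (subst₂ C₅ (sym v≡) (sym w≡) pq)) (adj⁺ (subst₂ C₅ (sym v′≡) (sym w′≡) p′q′))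
           (¬pq′ ∘ subst₂ C₅ v≡ w′≡ ∘ adj⁻)
      where
      cover : ∀ j → j ∈ₛ bagsOf A ⊎ j ∈ₛ bagsOf (∁ A)
      cover j with place j x ∈ₛ? A
      ... | yes m = inj₁ (subst (_∈ₛ bagsOf A) (bag-place j x) (bagsOf⁺ m))
      ... | no ¬m = inj₂ (subst (_∈ₛ bagsOf (∁ A)) (bag-place j x) (bagsOf⁺ (x∉p⇒x∈∁p ¬m)))

    -- Fewer than `k` edges occupy a set `Z` of fewer than `n` vertices. Outside `Z` there remain a
    -- vertex on each side of the cut and a vertex in every bag, hence a path of at most two edges
    -- across the cut.
    matching-≥ : ∀ {k} → k + k ≤ n → k ≤ maxMatching G A
    matching-≥ {k} 2k≤n = greedyMatching G A k extend
      where
      module _ (es : List (V G × V G)) (short : length es < k) where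
        Z = map proj₁ es ++ map proj₂ es

        Z<n : length Z < n
        Z<n = begin-strict
          length Z                                    ≡⟨ length-++ (map proj₁ es) ⟩
          length (map proj₁ es) + length (map proj₂ es) ≡⟨ cong₂ _+_ (length-map proj₁ es) (length-map proj₂ es) ⟩
          length es + length es                       <⟨ ℕ.+-mono-< short short ⟩
          k + k                                       ≤⟨ 2k≤n ⟩
          n                                           ∎
          where open ℕ.≤-Reasoning

        rep : ∀ j → ∃ λ u → bag u ≡ j × ¬ u ∈ₗ Z
        rep j with escape ⟪ (λ u → bag u ≟ᶠ j) ⟫ Z (ℕ.<-≤-trans Z<n (injection⇒≤∣p∣ _ (place j)
                     place-injective λ x → ∈⟪⟫⁺ (λ u → bag u ≟ᶠ j) (bag-place j x)))
        ... | u , u∈ , u∉Z = u , ∈⟪⟫⁻ (λ u → bag u ≟ᶠ j) u∈ , u∉Z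

        fresh : ∀ {a b} → a ∈ₛ A → b ∉ₛ A → a ~ b → ¬ a ∈ₗ Z → ¬ b ∈ₗ Z →
                ∃ λ e → CutEdge G A e × All (Disjoint G A e) es
        fresh {a} {b} a∈ b∉ a~b a∉Z b∉Z = (a , b) , (a∈ , x∉p⇒x∈∁p b∉ , a~b) , All-tabulate λ m →
          (λ { refl → a∉Z (∈-++⁺ˡ (∈-map⁺ proj₁ m)) }) , (λ { refl → b∉Z (∈-++⁺ʳ (map proj₁ es) (∈-map⁺ proj₂ m)) })

        extend : ∃ λ e → CutEdge G A e × All (Disjoint G A e) es
        extend with escape A Z (ℕ.<-trans Z<n n<A) | escape (∁ A) Z (ℕ.<-trans Z<n n<∁A)
        ... | a , a∈ , a∉Z | b , b∈ , b∉Z with C₅-diameter (bag a) (bag b)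
        ...   | inj₁ a~b = fresh a∈ (x∈∁p⇒x∉p b∈) (adj⁺ a~b) a∉Z b∉Z
        ...   | inj₂ (s , as , sb) with rep s
        -- Whichever side `r` is on, one of the edges `ar` and `rb` crosses the cut.
        ...     | r , refl , r∉Z with r ∈ₛ? A
        ...       | yes r∈ = fresh r∈ (x∈∁p⇒x∉p b∈) (adj⁺ sb) r∉Z b∉Z
        ...       | no r∉  = fresh a∈ r∉ (adj⁺ as) a∉Z r∉Z

  smw-≥ : ∀ {k} → 2 ≤ n → k + k ≤ n → min smw G ≥ k
  smw-≥ {k} 2≤n 2k≤n _ (D , refl) =
    -- All vertices are marked, and more than `n` of them are wanted on both sides; 3(n + 1) ≤ 5n
    -- holds from n = 2 on.
    let A , ≤width , p , q = Cuts.balancedCut D {s = n} id id 3n+3≤order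
        n<A  = ℕ.≤-trans p (p⊆q⇒∣p∣≤∣q∣ (∈⟪⟫⁻ (_∈ₛ? A)))
        n<∁A = ℕ.≤-trans q (p⊆q⇒∣p∣≤∣q∣ λ m → x∉p⇒x∈∁p (x∈∁p⇒x∉p m ∘ ∈⟪⟫⁺ (_∈ₛ? A)))
    in ℕ.≤-trans
         (splitMatching-≥ G A (notSplit A n<A n<∁A (fromℕ< (ℕ.≤-trans (s≤s z≤n) 2≤n))) (matching-≥ A n<A n<∁A 2k≤n))
         (≤width (splitMatching G))
    where
    3n+3≤order : 3 * suc n ≤ Graph.order G
    3n+3≤order = begin
      3 * suc n         ≡⟨ ℕ.*-suc 3 n ⟩
      3 + 3 * n         ≤⟨ ℕ.+-monoˡ-≤ (3 * n) (ℕ.≤-trans (ℕ.n≤1+n 3) (ℕ.*-monoʳ-≤ 2 2≤n)) ⟩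
      2 * n + 3 * n     ≡⟨ ℕ.*-distribʳ-+ n 2 3 ⟨
      5 * n             ≤⟨ 5n≤order ⟩
      Graph.order G     ∎
      where open ℕ.≤-Reasoning

-- Subdivided complete bipartite graphs joined by a clique

-- The 1-subdivision of the complete bipartite graph K_{k,N}.
module Core (k N : ℕ) where

  -- Column `j` consists of its hub, which is a vertex of the class of size `N`, and of the `k`
  -- subdivision vertices on the edges at it.
  Core : Set
  Core = Fin k ⊎ (Fin N × Fin (suc k))

  pattern row i   = inj₁ i
  pattern hub j   = inj₂ (j , zero)
  pattern mid i j = inj₂ (j , suc i)

  enumCore : Core ↔ Fin (k + N * suc k)
  enumCore = ↔-sym +↔⊎ ↔-∘ (↔-id _ ⊎-↔ ↔-sym *↔×)

  from-injective : ∀ {u v} → Inverse.from enumCore u ≡ Inverse.from enumCore v → u ≡ v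
  from-injective e = trans (sym (Inverse.strictlyInverseˡ enumCore _))
    (trans (cong (Inverse.to enumCore) e) (Inverse.strictlyInverseˡ enumCore _))

  CoreArc : Core → Core → Set
  CoreArc (row i)  (mid i′ _) = i ≡ i′
  CoreArc (hub j)  (mid _ j′) = j ≡ j′
  CoreArc (row _)  (row _)    = ⊥
  CoreArc (row _)  (hub _)    = ⊥
  CoreArc (hub _)  (row _)    = ⊥
  CoreArc (hub _)  (hub _)    = ⊥
  CoreArc (mid _ _) _         = ⊥

  coreArc? : ∀ g h → Dec (CoreArc g h)
  coreArc? (row i)   (mid i′ _) = i ≟ᶠ i′
  coreArc? (hub j)   (mid _ j′) = j ≟ᶠ j′
  coreArc? (row _)   (row _)    = no λ ()
  coreArc? (row _)   (hub _)    = no λ ()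
  coreArc? (hub _)   (row _)    = no λ ()
  coreArc? (hub _)   (hub _)    = no λ ()
  coreArc? (mid _ _) _          = no λ ()

  coreArc-irr : ∀ {h} → ¬ CoreArc h h
  coreArc-irr {row _}   ()
  coreArc-irr {hub _}   ()
  coreArc-irr {mid _ _} ()

  CoreAdj : Core → Core → Set
  CoreAdj g h = CoreArc g h ⊎ CoreArc h g

  InRow : Fin k → Core → Set
  InRow i (row i′)   = i ≡ i′
  InRow i (mid i′ _) = i ≡ i′
  InRow i (hub _)    = ⊥

  InCol : Fin N → Core → Set
  InCol j (row _)        = ⊥
  InCol j (inj₂ (j′ , _)) = j ≡ j′

  -- Without the hubs the core falls into stars, one for each row. Edges chosen in different stars
  -- therefore form an induced matching. For columns the row vertices are left out instead.
  adj-sameRow : ∀ {i i′ g h} → InRow i g → InRow i′ h → CoreAdj g h → i ≡ i′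
  adj-sameRow {g = row _}   {mid _ _} refl refl (inj₁ refl) = refl
  adj-sameRow {g = mid _ _} {row _}   refl refl (inj₂ refl) = refl
  adj-sameRow {g = row _}   {row _}   _ _ (inj₁ ())
  adj-sameRow {g = row _}   {row _}   _ _ (inj₂ ())
  adj-sameRow {g = mid _ _} {mid _ _} _ _ (inj₁ ())
  adj-sameRow {g = mid _ _} {mid _ _} _ _ (inj₂ ())

  adj-sameCol : ∀ {j j′ g h} → InCol j g → InCol j′ h → CoreAdj g h → j ≡ j′
  adj-sameCol {g = hub _}   {mid _ _} refl refl (inj₁ refl) = refl
  adj-sameCol {g = mid _ _} {hub _}   refl refl (inj₂ refl) = refl
  adj-sameCol {g = hub _}   {hub _}   _ _ (inj₁ ())
  adj-sameCol {g = hub _}   {hub _}   _ _ (inj₂ ())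
  adj-sameCol {g = mid _ _} {mid _ _} _ _ (inj₁ ())
  adj-sameCol {g = mid _ _} {mid _ _} _ _ (inj₂ ())

  module Colouring (χ : Core → Bool) where

    InducedMatching : Set
    InducedMatching = ∃₂ λ (a b : Fin k → Core) →
      (∀ i → χ (a i) ≡ true) × (∀ i → χ (b i) ≡ false) ×
      (∀ i → CoreAdj (a i) (b i)) × (∀ {i j} → i ≢ j → ¬ CoreAdj (a i) (b j))

    CrossingIn : (Core → Set) → Set
    CrossingIn P = ∃₂ λ a b → P a × P b × χ a ≡ true × χ b ≡ false × CoreAdj a b

    orient : ∀ {P : Core → Set} g h → P g → P h → CoreAdj g h → χ g ≢ χ h → CrossingIn P
    orient g h pg ph e ≢ with χ g in eg | χ h in eh
    ... | true  | false = g , h , pg , ph , eg , eh , e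
    ... | false | true  = h , g , ph , pg , eh , eg , [ inj₂ , inj₁ ]′ e
    ... | true  | true  = contradiction refl ≢
    ... | false | false = contradiction refl ≢

    collect : ∀ {A : Set} {P : A → Core → Set} → (∀ {s t g h} → P s g → P t h → CoreAdj g h → s ≡ t) →
              (star : Fin k → A) → (∀ {i j} → star i ≡ star j → i ≡ j) →
              (∀ i → CrossingIn (P (star i))) → InducedMatching
    collect same star star-inj crossing =
      (λ i → proj₁ (crossing i)) , (λ i → proj₁ (proj₂ (crossing i))) ,
      (λ i → let _ , _ , _ , _ , a , _ , _ = crossing i in a) ,
      (λ i → let _ , _ , _ , _ , _ , b , _ = crossing i in b) ,
      (λ i → let _ , _ , _ , _ , _ , _ , e = crossing i in e) ,
      λ {i} {j} i≢j e → let _ , _ , p , _ = crossing i ; _ , _ , _ , q , _ = crossing j in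
        i≢j (star-inj (same p q e))

    -- Counts the vertices whose colour is not `c`. The threshold is the number of vertices in the
    -- centres of all rows and in `k` columns together.
    Many : Bool → Set
    Many c = k + k * suc k < ∣ ⟪ (λ u → ¬? (χ (Inverse.from enumCore u) ≟ᵇ c)) ⟫ ∣

    -- Either every row is cut, or some row is monochromatic and then every
    -- column with a vertex of the other colour is cut.
    inducedMatching : Many true → Many false → InducedMatching
    inducedMatching manyT manyF with all? (λ i → any? (λ j → ¬? (χ (row i) ≟ᵇ χ (mid i j))))
    ... | yes mixed = collect adj-sameRow id id λ i →
            let j , ≢ = mixed i in orient (row i) (mid i j) refl refl (inj₁ refl) ≢
    ... | no ¬mixed = collect adj-sameCol (λ i → nth J (inject≤ i k≤J))
            (λ e → inject≤-injective k≤J k≤J _ _ (nth-injective J e))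
            (λ i → crossing _ (J⁻ (nth-∈ J (inject≤ i k≤J))))
      where
      mono = ¬∀⟶∃¬ k _ (λ i → any? (λ j → ¬? (χ (row i) ≟ᵇ χ (mid i j)))) ¬mixed
      i₀ = proj₁ mono
      c = χ (row i₀)

      monochromatic : ∀ j → χ (mid i₀ j) ≡ c
      monochromatic j = sym (decidable-stable (χ (row i₀) ≟ᵇ χ (mid i₀ j)) (λ ≢ → proj₂ mono (j , ≢)))

      hit? : ∀ j → Dec (∃ λ x → χ (inj₂ (j , x)) ≢ c)
      hit? j = any? λ x → ¬? (χ (inj₂ (j , x)) ≟ᵇ c)

      J : Subset N
      J = ⟪ hit? ⟫

      J⁻ : ∀ {j} → j ∈ₛ J → ∃ λ x → χ (inj₂ (j , x)) ≢ c
      J⁻ = ∈⟪⟫⁻ hit?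

      -- The vertex `mid i₀ j` has colour `c`. If the hub differs from it, their edge is cut;
      -- otherwise the hub has colour `c`, and its edge to the vertex of the other colour is cut.
      crossing : ∀ j → (∃ λ x → χ (inj₂ (j , x)) ≢ c) → CrossingIn (InCol j)
      crossing j (zero  , ≢c) = orient (hub j) (mid i₀ j) refl refl (inj₁ refl) (λ e → ≢c (trans e (monochromatic j)))
      crossing j (suc i , ≢c) with χ (hub j) ≟ᵇ c
      ... | yes ≡c = orient (hub j) (mid i j) refl refl (inj₁ refl) (λ e → ≢c (trans (sym e) ≡c))
      ... | no hub≢c = crossing j (zero , hub≢c)

      other? : Decidable (λ u → χ (Inverse.from enumCore u) ≢ c)
      other? u = ¬? (χ (Inverse.from enumCore u) ≟ᵇ c)

      position : ∀ h → χ h ≢ c → Fin k ⊎ Fin (∣ J ∣ * suc k)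
      position (row i)        _  = inj₁ i
      position (inj₂ (j , x)) ≢c = inj₂ (combine (index J (∈⟪⟫⁺ hit? (x , ≢c))) x)

      position-injective : ∀ g h (p : χ g ≢ c) (q : χ h ≢ c) → position g p ≡ position h q → g ≡ h
      position-injective (row i) (row .i) p q refl = refl
      position-injective (inj₂ (j , x)) (inj₂ (j′ , x′)) p q e =
        cong₂ (λ j x → inj₂ (j , x))
          (index-injective J (∈⟪⟫⁺ hit? (x , p)) (∈⟪⟫⁺ hit? (x′ , q))
            (combine-injectiveˡ {m = ∣ J ∣} _ x _ x′ (inj₂-injective e)))
          (combine-injectiveʳ {m = ∣ J ∣} _ x _ x′ (inj₂-injective e))

      join-injective : ∀ (x y : Fin k ⊎ Fin (∣ J ∣ * suc k)) → join k _ x ≡ join k _ y → x ≡ y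
      join-injective x y e = trans (sym (splitAt-join k _ x)) (trans (cong (splitAt k) e) (splitAt-join k _ y))

      -- A vertex not coloured `c` is the centre of a row or lies in a column of `J`. Against
      -- `Many c`, this forces at least `k` columns into `J`.
      others≤ : ∣ ⟪ other? ⟫ ∣ ≤ k + ∣ J ∣ * suc k
      others≤ = injection⇒∣p∣≤ ⟪ other? ⟫ (λ {u} u∈ → join k _ (position (Inverse.from enumCore u) (∈⟪⟫⁻ other? u∈)))
        λ {u} {v} u∈ v∈ e → from-injective (position-injective _ _ _ _ (join-injective (position _ _) (position _ _) e))

      many : ∀ b → Many b
      many true  = manyT
      many false = manyF

      k≤J : k ≤ ∣ J ∣
      k≤J with ℕ.≤-total k ∣ J ∣
      ... | inj₁ p = p
      ... | inj₂ q = contradiction (ℕ.≤-trans others≤ (ℕ.+-monoʳ-≤ k (ℕ.*-monoˡ-≤ (suc k) q))) (ℕ.<⇒≱ (many c))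

  module _ {G : Graph} (3s≤N : 3 * suc (k + k * suc k) ≤ N)
           (e : Core → V G) (e-inj : ∀ {g h} → e g ≡ e h → g ≡ h)
           (adj⁺ : ∀ {g h} → CoreAdj g h → Graph._~_ G (e g) (e h))
           (adj⁻ : ∀ {g h} → Graph._~_ G (e g) (e h) → CoreAdj g h) where

    private
      χ : Subset (Graph.order G) → Core → Bool
      χ A h = does (e h ∈ₛ? A)

      χ-true : ∀ A {h} → χ A h ≡ true → e h ∈ₛ A
      χ-true A {h} eq with e h ∈ₛ? A | eq
      ... | yes m | _  = m
      ... | no _  | ()

      χ-false : ∀ A {h} → χ A h ≡ false → e h ∉ₛ A
      χ-false A {h} eq m with trans (sym (dec-true (e h ∈ₛ? A) m)) eq
      ... | ()

      side : Subset (Graph.order G) → Subset (k + N * suc k)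
      side A = ⟪ (λ u → e (Inverse.from enumCore u) ∈ₛ? A) ⟫

      out⊆ : ∀ A → ∁ (side A) ⊆ ⟪ (λ u → ¬? (χ A (Inverse.from enumCore u) ≟ᵇ true)) ⟫
      out⊆ A {u} m = ∈⟪⟫⁺ (λ u → ¬? (χ A (Inverse.from enumCore u) ≟ᵇ true)) λ eq →
        x∈∁p⇒x∉p m (∈⟪⟫⁺ (λ u → e (Inverse.from enumCore u) ∈ₛ? A) (χ-true A eq))

      in⊆ : ∀ A → side A ⊆ ⟪ (λ u → ¬? (χ A (Inverse.from enumCore u) ≟ᵇ false)) ⟫
      in⊆ A {u} m = ∈⟪⟫⁺ (λ u → ¬? (χ A (Inverse.from enumCore u) ≟ᵇ false)) λ eq →
        χ-false A eq (∈⟪⟫⁻ (λ u → e (Inverse.from enumCore u) ∈ₛ? A) m)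

      balanced-cutRank : ∀ A → suc (k + k * suc k) ≤ ∣ side A ∣ → suc (k + k * suc k) ≤ ∣ ∁ (side A) ∣ → k ≤ cutRank G A
      balanced-cutRank A p q =
        let a , b , aT , bF , a~b , a≁b = Colouring.inducedMatching (χ A)
              (ℕ.≤-trans q (p⊆q⇒∣p∣≤∣q∣ (out⊆ A))) (ℕ.≤-trans p (p⊆q⇒∣p∣≤∣q∣ (in⊆ A)))
        in cutRank-≥ G A (e ∘ a) (e ∘ b) (λ i → χ-true A (aT i)) (λ i → χ-false A (bF i))
             (λ i → adj⁺ (a~b i)) (λ i≢j → a≁b i≢j ∘ adj⁻)

    -- Stated for any graph with an induced copy of the core, because the component of `G [ X ]ᵍ` to
    -- which it is applied can be larger. The vertices of the copy are marked, and the induced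
    -- matching in a balanced cut is an identity submatrix.
    core-rankWidth : min rankWidth G ≥ k
    core-rankWidth _ (D , refl) =
      let A , ≤width , p , q = Cuts.balancedCut D (e ∘ Inverse.from enumCore) (from-injective ∘ e-inj)
            (ℕ.≤-trans 3s≤N (ℕ.≤-trans (ℕ.m≤m*n N (suc k)) (ℕ.m≤n+m (N * suc k) k)))
      in ℕ.≤-trans (balanced-cutRank A p q) (≤width (cutRank G))

-- The host: copies of the core with apices that form a clique.

module Host (k N m : ℕ) where
  open Core k N public

  Name : Set
  Name = Fin m × (⊤ ⊎ Core)

  pattern apex v   = v , inj₁ tt
  pattern core v h = v , inj₂ h

  enumName : Name ↔ Fin (m * (1 + (k + N * suc k)))
  enumName = ↔-sym *↔× ↔-∘ (↔-id _ ×-↔ (↔-sym +↔⊎ ↔-∘ (↔-sym 1↔⊤ ⊎-↔ enumCore)))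

  HostArc : Name → Name → Set
  HostArc (apex v)   (apex w)   = v ≢ w
  HostArc (apex v)   (core w _) = v ≡ w
  HostArc (core _ _) (apex _)   = ⊥
  HostArc (core v g) (core w h) = v ≡ w × CoreArc g h

  hostArc? : ∀ a b → Dec (HostArc a b)
  hostArc? (apex v)   (apex w)   = ¬? (v ≟ᶠ w)
  hostArc? (apex v)   (core w _) = v ≟ᶠ w
  hostArc? (core _ _) (apex _)   = no λ ()
  hostArc? (core v g) (core w h) = (v ≟ᶠ w) ×-dec coreArc? g h

  hostArc-irr : ∀ {a} → ¬ HostArc a a
  hostArc-irr {apex v}   ≢       = ≢ refl
  hostArc-irr {core v h} (_ , e) = coreArc-irr {h} e

  HostAdj : Name → Name → Set
  HostAdj a b = HostArc a b ⊎ HostArc b a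

  -- An interface that hides the numbering `enumName`; both bounds work with names.
  record IsHost (G : Graph) : Set where
    open Graph G using (_~_)
    field
      code      : Name → V G
      name      : V G → Name
      name-code : ∀ a → name (code a) ≡ a
      code-name : ∀ u → code (name u) ≡ u
      adj⁺      : ∀ {a b} → HostAdj a b → code a ~ code b
      adj⁻      : ∀ {a b} → code a ~ code b → HostAdj a b

    code-injective : ∀ {a b} → code a ≡ code b → a ≡ b
    code-injective e = trans (sym (name-code _)) (trans (cong name e) (name-code _))

  host : ∃ IsHost
  host = graph , record
    { code = code ; name = name ; name-code = name-code ; code-name = code-name ; adj⁺ = adj
    ; adj⁻ = λ {a} {b} → subst₂ HostAdj (name-code a) (name-code b) }
    where open ArcGraph enumName HostArc hostArc? (λ {a} → hostArc-irr {a})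

-- Cliques in the torsos of the host.

module _ {c N m : ℕ} (3s≤N : 3 * suc (suc c + suc c * suc (suc c)) ≤ N) {G : Graph} where
  open Host (suc c) N m

  module _ (isHost : IsHost G) where
    open IsHost isHost
    open Graph G using (_~_; _~?_)

    Escapes : Subset (Graph.order G) → Set
    Escapes X = ∀ v → code (apex v) ∈ₛ X → ¬ (∀ h → code (core v h) ∈ₛ X)

    module _ {X} (torso : IsTorso c G X) where

      -- The apex is adjacent to its whole core. If all of them were in `X`, the core would lie in a
      -- single component of `G [ X ]ᵍ`, which would then have rank-width at least c + 1.
      copy⊈X : Escapes X
      copy⊈X v apex∈ core∈ =
        let w , rw , w≤c = torso u
        in ℕ.<⇒≱ (core-rankWidth {G[X] [ C ]ᵍ} 3s≤N e e-inj
             (λ {g} {h} → e-adj⁺ {g} {h}) (λ {g} {h} → e-adj⁻ {g} {h}) w rw) w≤c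
        where
        G[X] = G [ X ]ᵍ
        u : V G[X]
        u = index X apex∈
        C = component G[X] u
        i : Core → V G[X]
        i h = index X (core∈ h)

        u~i : ∀ h → Graph._~_ G[X] u (i h)
        u~i h = subst₂ _~_ (sym (nth-index X apex∈)) (sym (nth-index X (core∈ h))) (adj⁺ {apex v} {core v h} (inj₁ refl))

        i∈C : ∀ h → i h ∈ₛ C
        i∈C h = Walks.∈component⁺ G[X] {u} {i h} (u~i h ◅ ε)

        e : Core → V (G[X] [ C ]ᵍ)
        e h = index C (i∈C h)

        place : ∀ h → nth X (nth C (e h)) ≡ code (core v h)
        place h = trans (cong (nth X) (nth-index C (i∈C h))) (nth-index X (core∈ h))

        e-inj : ∀ {g h} → e g ≡ e h → g ≡ h
        e-inj {g} {h} eq = core-injective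
          (code-injective (trans (sym (place g)) (trans (cong (nth X ∘ nth C) eq) (place h))))
          where
          core-injective : ∀ {v w g h} → (core v g) ≡ (core w h) → g ≡ h
          core-injective refl = refl

        e-adj⁺ : ∀ {g h} → CoreAdj g h → nth X (nth C (e g)) ~ nth X (nth C (e h))
        e-adj⁺ {g} {h} a = subst₂ _~_ (sym (place g)) (sym (place h)) (adj⁺ (lift a))
          where
          lift : CoreAdj g h → HostAdj (core v g) (core v h)
          lift (inj₁ a) = inj₁ (refl , a)
          lift (inj₂ a) = inj₂ (refl , a)

        e-adj⁻ : ∀ {g h} → nth X (nth C (e g)) ~ nth X (nth C (e h)) → CoreAdj g h
        e-adj⁻ {g} {h} a = lower (adj⁻ {core v g} {core v h} (subst₂ _~_ (place g) (place h) a))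
          where
          lower : HostAdj (core v g) (core v h) → CoreAdj g h
          lower (inj₁ (_ , a)) = inj₁ a
          lower (inj₂ (_ , a)) = inj₂ a

    module _ {X} (escapes : Escapes X) where

      Exit : Fin m → Set
      Exit v = code (apex v) ∉ₛ X ⊎ (code (apex v) ∈ₛ X × ∃ λ h → code (core v h) ∉ₛ X)

      exit : ∀ v → Exit v
      exit v with code (apex v) ∈ₛ? X | any? (λ i → ¬? (code (core v (Inverse.from enumCore i)) ∈ₛ? X))
      ... | no ∉  | _           = inj₁ ∉
      ... | yes ∈ | yes (i , ∉) = inj₂ (∈ , _ , ∉)
      ... | yes ∈ | no all      = ⊥-elim (escapes v ∈ λ h →
        subst (λ h → code (core v h) ∈ₛ X) (Inverse.strictlyInverseʳ enumCore h) (decidable-stable (_ ∈ₛ? X) λ ∉ → all (Inverse.to enumCore h , ∉)))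

      exitVertex : ∀ {v} → Exit v → Name
      exitVertex {v} (inj₁ _)           = apex v
      exitVertex {v} (inj₂ (_ , h , _)) = core v h

      exit∉X : ∀ {v} (x : Exit v) → code (exitVertex x) ∉ₛ X
      exit∉X (inj₁ ∉)           = ∉
      exit∉X (inj₂ (_ , _ , ∉)) = ∉

      private
        differ : ∀ {a b} → a ≢ b → code a ≢ code b
        differ ≢ = ≢ ∘ code-injective

      -- An exit other than the apex occurs only if the apex is in `X`, so the path can run through
      -- the apices of the two copies.
      exits-linked : ∀ {v w} (x : Exit v) (y : Exit w) → v ≢ w →
                     PathThrough G X (code (exitVertex x)) (code (exitVertex y))
      exits-linked {v} {w} (inj₁ _) (inj₁ _) v≢w =
        [] , [] , adj⁺ {apex v} {apex w} (inj₁ v≢w) ∷ [-] ,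
        (differ (λ { refl → v≢w refl }) ∷ []) ∷ [] ∷ []
      exits-linked {v} {w} (inj₁ _) (inj₂ (w∈ , h , _)) v≢w =
        [ code (apex w) ] , w∈ ∷ [] ,
        adj⁺ {apex v} {apex w} (inj₁ v≢w) ∷ adj⁺ {apex w} {core w h} (inj₁ refl) ∷ [-] ,
        (differ (λ { refl → v≢w refl }) ∷ differ (λ ()) ∷ []) ∷ (differ (λ ()) ∷ []) ∷ [] ∷ []
      exits-linked {v} {w} (inj₂ (v∈ , g , _)) (inj₁ _) v≢w =
        [ code (apex v) ] , v∈ ∷ [] ,
        adj⁺ {core v g} {apex v} (inj₂ refl) ∷ adj⁺ {apex v} {apex w} (inj₁ v≢w) ∷ [-] ,
        (differ (λ ()) ∷ differ (λ ()) ∷ []) ∷ (differ (λ { refl → v≢w refl }) ∷ []) ∷ [] ∷ []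
      exits-linked {v} {w} (inj₂ (v∈ , g , _)) (inj₂ (w∈ , h , _)) v≢w =
        code (apex v) ∷ code (apex w) ∷ [] , v∈ ∷ w∈ ∷ [] ,
        adj⁺ {core v g} {apex v} (inj₂ refl) ∷ adj⁺ {apex v} {apex w} (inj₁ v≢w) ∷
        adj⁺ {apex w} {core w h} (inj₁ refl) ∷ [-] ,
        (differ (λ ()) ∷ differ (λ ()) ∷ differ (λ { refl → v≢w refl }) ∷ []) ∷
        (differ (λ { refl → v≢w refl }) ∷ differ (λ ()) ∷ []) ∷ (differ (λ ()) ∷ []) ∷ [] ∷ []

      clique : Fin m → V (G ∘ᵍ X)
      clique v = index (∁ X) (x∉p⇒x∈∁p (exit∉X (exit v)))

      clique-adj : ∀ {v w} → v ≢ w → Graph._~_ (G ∘ᵍ X) (clique v) (clique w)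
      clique-adj {v} {w} v≢w = subst₂ (λ a b → a ~ b ⊎ (¬ a ~ b × PathThrough G X a b))
        (sym (nth-index (∁ X) (x∉p⇒x∈∁p (exit∉X (exit v))))) (sym (nth-index (∁ X) (x∉p⇒x∈∁p (exit∉X (exit w))))) near
        where
        a = code (exitVertex (exit v))
        b = code (exitVertex (exit w))
        near : a ~ b ⊎ (¬ a ~ b × PathThrough G X a b)
        near with a ~? b
        ... | yes a~b = inj₁ a~b
        ... | no a≁b = inj₂ (a≁b , exits-linked (exit v) (exit w) v≢w)

-- i + 1 copies are taken since a clique of size i + 1 forces width `i`.
host-𝓡-treewidth : ∀ {c N i} → 3 * suc (suc c + suc c * suc (suc c)) ≤ N → ∀ {G} →
                   Host.IsHost (suc c) N (suc i) G → min 𝓡-treewidth c G ≥ i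
host-𝓡-treewidth 3s≤N {G} isHost w (X , torso , (D , refl) , _) =
  clique⇒width≥ {G ∘ᵍ X} D (clique 3s≤N isHost {X} escapes) (clique-adj 3s≤N isHost {X} escapes)
  where
  escapes = copy⊈X 3s≤N isHost {X} torso

-- The split-matching-width of the host.

module _ {k N m : ℕ} {G : Graph} (isHost : Host.IsHost (suc k) (suc N) (suc m) G) where
  open Host (suc k) (suc N) (suc m)
  open IsHost isHost
  open Graph G using (_~_; sym~)

  private
    κ = splitMatching G

  module _ (A : Subset (Graph.order G)) where

    private
      _∈A : Name → Set
      a ∈A = code a ∈ₛ A

      _∉A : Name → Set
      a ∉A = code a ∉ₛ A

    -- Unoriented, so that a cover for `A` serves for `∁ A` too.
    Cut : Name → Name → Set
    Cut a b = (a ∈A × b ∉A) ⊎ (b ∈A × a ∉A)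

    cover-κ : ∀ {l} → 1 ≤ l → (Z : List (V G)) → length Z ≤ l →
              (∀ {a b} → HostArc a b → Cut a b → code a ∈ₗ Z ⊎ code b ∈ₗ Z) → κ A ≤ l
    cover-κ 1≤l Z Z≤l cover = splitMatching-≤ G A 1≤l λ _ → ℕ.≤-trans (maxMatching-≤ G A Z covered) Z≤l
      where
      named : ∀ {a b} → a ∈A → b ∉A → HostAdj a b → code a ∈ₗ Z ⊎ code b ∈ₗ Z
      named a∈ b∉ (inj₁ e) = cover e (inj₁ (a∈ , b∉))
      named a∈ b∉ (inj₂ e) = [ inj₂ , inj₁ ]′ (cover e (inj₂ (a∈ , b∉)))
      covered : ∀ {u v} → u ∈ₛ A → v ∉ₛ A → u ~ v → u ∈ₗ Z ⊎ v ∈ₗ Z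
      covered {u} {v} = subst₂ (λ u v → u ∈ₛ A → v ∉ₛ A → u ~ v → u ∈ₗ Z ⊎ v ∈ₗ Z) (code-name u) (code-name v)
        (λ a∈ b∉ e → named a∈ b∉ (adj⁻ e))

    Copywise : Set
    Copywise = ∀ {v x y} → (v , x) ∈A → (v , y) ∈A

    module _ (copywise : Copywise) where

      private
        crossing : ∀ {a b} → a ∈A → b ∉A → HostAdj a b → ∃₂ λ v w → a ≡ apex v × b ≡ apex w × v ≢ w
        crossing {apex v}   {apex w}   _ _ (inj₁ ≢)          = v , w , refl , refl , ≢
        crossing {apex v}   {apex w}   _ _ (inj₂ ≢)          = v , w , refl , refl , ≢ ∘ sym
        crossing {apex v}   {core w h} a∈ b∉ (inj₁ refl)     = contradiction (copywise a∈) b∉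
        crossing {core v g} {apex w}   a∈ b∉ (inj₂ refl)     = contradiction (copywise a∈) b∉
        crossing {core v g} {core w h} a∈ b∉ (inj₁ (refl , _)) = contradiction (copywise a∈) b∉
        crossing {core v g} {core w h} a∈ b∉ (inj₂ (refl , _)) = contradiction (copywise a∈) b∉

        crossing′ : ∀ {u x} → u ∈ₛ A → x ∉ₛ A → u ~ x → ∃₂ λ v w → u ≡ code (apex v) × x ≡ code (apex w) × v ≢ w
        crossing′ {u} {x} = subst₂
          (λ u x → u ∈ₛ A → x ∉ₛ A → u ~ x → ∃₂ λ v w → u ≡ code (apex v) × x ≡ code (apex w) × v ≢ w)
          (code-name u) (code-name x) λ a∈ b∉ e →
            let v , w , p , q , ≢ = crossing a∈ b∉ (adj⁻ e) in v , w , cong code p , cong code q , ≢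

        sameOuter : ∀ {u v x} → u ∈ₛ A → v ∈ₛ A → x ∉ₛ A → u ~ x →
                    ∃ (λ y → y ∉ₛ A × v ~ y) → v ~ x
        sameOuter u∈ v∈ x∉ u~x (y , y∉ , v~y) with crossing′ u∈ x∉ u~x | crossing′ v∈ y∉ v~y
        ... | _ , w , refl , refl , _ | v , _ , refl , refl , _ =
          adj⁺ {apex v} {apex w} (inj₁ λ { refl → x∉ v∈ })

        twoOf : ∀ (p : Subset (Graph.order G)) v → (∀ x → code (v , x) ∈ₛ p) → 2 ≤ ∣ p ∣
        twoOf p v ∈p = injection⇒≤∣p∣ p pick inj (λ { zero → ∈p _ ; (suc _) → ∈p _ })
          where
          pick : Fin 2 → V G
          pick zero    = code (apex v)
          pick (suc _) = code (core v (inj₁ zero))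
          inj : ∀ {i j} → pick i ≡ pick j → i ≡ j
          inj {zero}     {zero}     _ = refl
          inj {suc zero} {suc zero} _ = refl
          inj {zero}     {suc zero} e with () ← code-injective e
          inj {suc zero} {zero}     e with () ← code-injective e

        -- Only edges between apices cross, and each apex in `A` is adjacent to all apices outside.
        -- Each side contains a whole copy, hence two vertices.
        split : ∀ {v w} → apex v ∈A → apex w ∉A → IsSplit G A
        split {v} {w} v∈ w∉ =
          twoOf A v (λ x → copywise v∈) ,
          twoOf (∁ A) w (λ x → x∉p⇒x∈∁p (w∉ ∘ copywise)) ,
          λ u u∈ v v∈ outU outV → ⊆-antisym (half u u∈ v v∈ outV) (half v v∈ u u∈ outU)
          where
          half : ∀ u → u ∈ₛ A → ∀ v → v ∈ₛ A → Nonempty (Graph.N G v ∩ ∁ A) → Graph.N G u ∩ ∁ A ⊆ Graph.N G v ∩ ∁ A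
          half u u∈ v v∈ (y , y∈) {x} x∈ =
            let x∈N , x∈∁ = x∈p∩q⁻ (Graph.N G u) (∁ A) x∈
                y∈N , y∈∁ = x∈p∩q⁻ (Graph.N G v) (∁ A) y∈
            in x∈p∩q⁺ (∈⟪⟫⁺ (Graph._~?_ G v) (sameOuter u∈ v∈ (x∈∁p⇒x∉p x∈∁) (∈⟪⟫⁻ (Graph._~?_ G u) x∈N)
                 (y , x∈∁p⇒x∉p y∈∁ , ∈⟪⟫⁻ (Graph._~?_ G v) y∈N)) , x∈∁)

      -- A crossing edge joins two apices and makes `A` a split; if `A` is no split, the empty list
      -- is a cover.
      copywise-κ : κ A ≤ 1
      copywise-κ = splitMatching-≤ G A ℕ.≤-refl λ ¬split → ℕ.≤-trans (maxMatching-≤ G A [] λ {u} {x} u∈ x∉ u~x →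
        let v , w , p , q , _ = crossing′ u∈ x∉ u~x
        in contradiction (split {v} {w} (subst (_∈ₛ A) p u∈) (subst (_∉ₛ A) q x∉)) ¬split) z≤n

  copywise-∁ : ∀ {A} → Copywise A → Copywise (∁ A)
  copywise-∁ copywise m = x∉p⇒x∈∁p (x∈∁p⇒x∉p m ∘ copywise)

  cut-∁ : ∀ {A a b} → Cut (∁ A) a b → Cut A a b
  cut-∁ (inj₁ (p , q)) = inj₂ (x∉∁p⇒x∈p q , x∈∁p⇒x∉p p)
  cut-∁ (inj₂ (p , q)) = inj₁ (x∉∁p⇒x∈p q , x∈∁p⇒x∉p p)

  module _ {A} (v : Fin (suc m)) (within : ∀ {w x} → code (w , x) ∈ₛ A → w ≡ v × ∃ λ h → x ≡ inj₂ h)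
           (j : Fin (suc N))
           (whole : ∀ {j′ x y} → j′ ≢ j → code (core v (inj₂ (j′ , x))) ∈ₛ A → code (core v (inj₂ (j′ , y))) ∈ₛ A) where

    -- Edges from `A` lead to the apex, meet a row vertex, or join a hub to its column. Among the
    -- columns only `j` can be cut, so one hub suffices; with k + 1 row vertices the cover has size
    -- k + 3.
    narrow-cover : List (V G)
    narrow-cover = code (apex v) ∷ code (core v (hub j)) ∷ map (λ i → code (core v (row i))) (allFin (suc k))

    narrow-cover-length : length narrow-cover ≡ 3 + k
    narrow-cover-length = cong (2 +_)
      (trans (length-map (λ i → code (core v (row i))) (allFin (suc k))) (length-tabulate {n = suc k} id))

    row∈cover : ∀ i → code (core v (row i)) ∈ₗ narrow-cover
    row∈cover i = there (there (∈-map⁺ (λ i → code (core v (row i))) (∈-allFin i)))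

    hub-covered : ∀ {j′ i′} → Cut A (core v (hub j′)) (core v (mid i′ j′)) → code (core v (hub j′)) ∈ₗ narrow-cover
    hub-covered {j′} cut with j′ ≟ᶠ j | cut
    ... | yes refl | _ = there (here refl)
    ... | no j′≢j | inj₁ (p , q) = contradiction (whole j′≢j p) q
    ... | no j′≢j | inj₂ (p , q) = contradiction (whole j′≢j p) q

    core-covered : ∀ {g h} → CoreArc g h → Cut A (core v g) (core v h) →
                   code (core v g) ∈ₗ narrow-cover ⊎ code (core v h) ∈ₗ narrow-cover
    core-covered {row i} {mid _ _} refl _   = inj₁ (row∈cover i)
    core-covered {hub j} {mid _ _} refl cut = inj₁ (hub-covered cut)

    narrow-covers : ∀ {a b} → HostArc a b → Cut A a b → code a ∈ₗ narrow-cover ⊎ code b ∈ₗ narrow-cover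
    narrow-covers {apex _}   {apex _}   _ (inj₁ (p , _)) with () ← proj₂ (within p)
    narrow-covers {apex _}   {apex _}   _ (inj₂ (p , _)) with () ← proj₂ (within p)
    narrow-covers {apex _}   {core _ _} _ (inj₁ (p , _)) with () ← proj₂ (within p)
    narrow-covers {apex _}   {core _ _} refl (inj₂ (p , _)) with refl ← proj₁ (within p) = inj₁ (here refl)
    narrow-covers {core _ _} {core _ _} (refl , e) cut@(inj₁ (p , _)) with refl ← proj₁ (within p) = core-covered e cut
    narrow-covers {core _ _} {core _ _} (refl , e) cut@(inj₂ (p , _)) with refl ← proj₁ (within p) = core-covered e cut

    narrow-κ : κ A ≤ 3 + k × κ (∁ A) ≤ 3 + k
    narrow-κ =
      cover-κ A (s≤s z≤n) narrow-cover (ℕ.≤-reflexive narrow-cover-length) narrow-covers ,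
      cover-κ (∁ A) (s≤s z≤n) narrow-cover (ℕ.≤-reflexive narrow-cover-length)
        (λ {a} {b} e → narrow-covers {a} {b} e ∘ cut-∁ {A} {a} {b})

  rowLeaf : Fin (suc m) → Fin (suc k) → Tree (V G)
  rowLeaf v i = leaf (code (core v (row i)))

  columnLeaf : Fin (suc m) → Fin (suc N) → Fin (2 + k) → Tree (V G)
  columnLeaf v j x = leaf (code (core v (inj₂ (j , x))))

  rowTree : Fin (suc m) → Tree (V G)
  rowTree v = caterpillar {n = k} (rowLeaf v)

  columnTree : Fin (suc m) → Fin (suc N) → Tree (V G)
  columnTree v j = caterpillar {n = suc k} (columnLeaf v j)

  -- With the rows split off first, a subtree of `coreTree` contains row vertices only, part of a
  -- single column, whole columns, or everything. In each case at most one column is cut.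
  coreTree copyTree : Fin (suc m) → Tree (V G)
  coreTree v = node (rowTree v) (caterpillar {n = N} (columnTree v))
  copyTree v = node (leaf (code (apex v))) (coreTree v)

  layout : Tree (V G)
  layout = caterpillar {n = m} copyTree

  row⁻ : ∀ {v u} → u ∈ᵗ rowTree v → ∃ λ i → u ≡ code (core v (row i))
  row⁻ {v} p = let i , q = ∈-caterpillar⁻ {n = k} (rowLeaf v) p in i , leaf-∈⁻ q

  column⁻ : ∀ {v j u} → u ∈ᵗ columnTree v j → ∃ λ x → u ≡ code (core v (inj₂ (j , x)))
  column⁻ {v} {j} p = let x , q = ∈-caterpillar⁻ {n = suc k} (columnLeaf v j) p in x , leaf-∈⁻ q

  columns⁻ : ∀ {v u} → u ∈ᵗ caterpillar {n = N} (columnTree v) → ∃₂ λ j x → u ≡ code (core v (inj₂ (j , x)))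
  columns⁻ {v} p = let j , q = ∈-caterpillar⁻ {n = N} (columnTree v) p in j , column⁻ {v} {j} q

  column⁺ : ∀ {v j} x → code (core v (inj₂ (j , x))) ∈ᵗ columnTree v j
  column⁺ {v} {j} x = ∈-caterpillar⁺ {n = suc k} (columnLeaf v j) x here

  core⁻ : ∀ {v u} → u ∈ᵗ coreTree v → ∃ λ h → u ≡ code (core v h)
  core⁻ {v} (left p)  = let i , e = row⁻ {v} p in _ , e
  core⁻ {v} (right p) = let j , x , e = columns⁻ {v} p in _ , e

  column⇒core : ∀ {v j u} → u ∈ᵗ columnTree v j → u ∈ᵗ coreTree v
  column⇒core {v} {j} p = right (∈-caterpillar⁺ {n = N} (columnTree v) j p)

  copy⁻ : ∀ {v u} → u ∈ᵗ copyTree v → ∃ λ x → u ≡ code (v , x)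
  copy⁻ (left p)      = _ , leaf-∈⁻ p
  copy⁻ {v} (right p) = let h , e = core⁻ {v} p in _ , e

  copy⁺ : ∀ v x → code (v , x) ∈ᵗ copyTree v
  copy⁺ v (inj₁ tt)              = left here
  copy⁺ v (inj₂ (row i))         = right (left (∈-caterpillar⁺ {n = k} (rowLeaf v) i here))
  copy⁺ v (inj₂ (inj₂ (j , x))) = right (column⇒core {v} {j} (column⁺ {v} {j} x))

  layout-complete : ∀ u → u ∈ᵗ layout
  layout-complete u = subst (_∈ᵗ layout) (code-name u) (∈-caterpillar⁺ {n = m} copyTree _ (copy⁺ _ (proj₂ (name u))))

  private
    same : ∀ {u a b} → u ≡ code a → u ≡ code b → a ≡ b
    same p q = code-injective (trans (sym p) q)

    rowEq : ∀ {v w i j} → _≡_ {A = Name} (core v (row i)) (core w (row j)) → i ≡ j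
    rowEq refl = refl

    columnEq : ∀ {v w j j′ x x′} → _≡_ {A = Name} (core v (inj₂ (j , x))) (core w (inj₂ (j′ , x′))) → j ≡ j′ × x ≡ x′
    columnEq refl = refl , refl

    row≢column : ∀ {v w i j x} → ¬ _≡_ {A = Name} (core v (row i)) (core w (inj₂ (j , x)))
    row≢column ()

    apex≢core : ∀ {v w h} → ¬ _≡_ {A = Name} (apex v) (core w h)
    apex≢core ()

  rowTree-unique : ∀ v {u} (p q : u ∈ᵗ rowTree v) → p ≡ q
  rowTree-unique v = caterpillar-unique {n = k} (rowLeaf v) (λ _ → leaf-unique)
    λ p q → rowEq (same (leaf-∈⁻ p) (leaf-∈⁻ q))

  columnTree-unique : ∀ v j {u} (p q : u ∈ᵗ columnTree v j) → p ≡ q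
  columnTree-unique v j = caterpillar-unique {n = suc k} (columnLeaf v j) (λ _ → leaf-unique)
    λ p q → proj₂ (columnEq (same (leaf-∈⁻ p) (leaf-∈⁻ q)))

  columns-unique : ∀ v {u} (p q : u ∈ᵗ caterpillar {n = N} (columnTree v)) → p ≡ q
  columns-unique v = caterpillar-unique {n = N} (columnTree v) (λ j → columnTree-unique v j)
    λ {i} {j} p q → proj₁ (columnEq (same (proj₂ (column⁻ {v} {i} p)) (proj₂ (column⁻ {v} {j} q))))

  copyTree-unique : ∀ v {u} (p q : u ∈ᵗ copyTree v) → p ≡ q
  copyTree-unique v (left p)          (left q)          = cong left (leaf-unique p q)
  copyTree-unique v (left p)          (right q)         = ⊥-elim (apex≢core (same (leaf-∈⁻ p) (proj₂ (core⁻ {v} q))))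
  copyTree-unique v (right p)         (left q)          = ⊥-elim (apex≢core (same (leaf-∈⁻ q) (proj₂ (core⁻ {v} p))))
  copyTree-unique v (right (left p))  (right (left q))  = cong (λ p → right (left p)) (rowTree-unique v p q)
  copyTree-unique v (right (left p))  (right (right q)) = ⊥-elim (row≢column
    (same (proj₂ (row⁻ {v} p)) (proj₂ (proj₂ (columns⁻ {v} q)))))
  copyTree-unique v (right (right p)) (right (left q))  = ⊥-elim (row≢column
    (same (proj₂ (row⁻ {v} q)) (proj₂ (proj₂ (columns⁻ {v} p)))))
  copyTree-unique v (right (right p)) (right (right q)) = cong (λ p → right (right p)) (columns-unique v p q)

  columnOf : ∀ {v w j j′ x} → code (core w (inj₂ (j′ , x))) ∈ᵗ columnTree v j → j′ ≡ j
  columnOf {v} {j = j} p = proj₁ (columnEq (same refl (proj₂ (column⁻ {v} {j} p))))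

  copyOf : ∀ {v w x} → code (w , x) ∈ᵗ copyTree v → w ≡ v
  copyOf {v} p = cong proj₁ (same refl (proj₂ (copy⁻ {v} p)))

  layout-unique : ∀ {u} (p q : u ∈ᵗ layout) → p ≡ q
  layout-unique = caterpillar-unique {n = m} copyTree (λ v → copyTree-unique v)
    λ {v} {w} p q → cong proj₁ (same (proj₂ (copy⁻ {v} p)) (proj₂ (copy⁻ {w} q)))

  module _ {A} {t : Tree (V G)} (A⊆ : ∀ {u} → u ∈ₛ A → u ∈ᵗ t) (⊆A : ∀ {u} → u ∈ᵗ t → u ∈ₛ A) where

    Bounded : Set
    Bounded = κ A ≤ 3 + k × κ (∁ A) ≤ 3 + k

    copies-bound : (∀ {v x y} → code (v , x) ∈ᵗ t → code (v , y) ∈ᵗ t) → Bounded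
    copies-bound closed = ℕ.≤-trans (copywise-κ A cw) (s≤s z≤n) , ℕ.≤-trans (copywise-κ (∁ A) (copywise-∁ {A} cw)) (s≤s z≤n)
      where
      cw : Copywise A
      cw = ⊆A ∘ closed ∘ A⊆

    apex-bound : ∀ {v} → (∀ {u} → u ∈ᵗ t → u ≡ code (apex v)) → Bounded
    apex-bound {v} only = bound A cover , bound (∁ A) (λ {a} {b} e → cover {a} {b} e ∘ cut-∁ {A} {a} {b})
      where
      Z = [ code (apex v) ]
      bound : ∀ B → _ → κ B ≤ 3 + k
      bound B = cover-κ B (s≤s z≤n) Z (s≤s z≤n)
      cover : ∀ {a b} → HostArc a b → Cut A a b → code a ∈ₗ Z ⊎ code b ∈ₗ Z
      cover _ (inj₁ (p , _)) = inj₁ (here (only (A⊆ p)))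
      cover _ (inj₂ (p , _)) = inj₂ (here (only (A⊆ p)))

    core-bound : ∀ {v} j → (∀ {u} → u ∈ᵗ t → u ∈ᵗ coreTree v) →
      (∀ {j′ x y} → j′ ≢ j → code (core v (inj₂ (j′ , x))) ∈ᵗ t → code (core v (inj₂ (j′ , y))) ∈ᵗ t) → Bounded
    core-bound {v} j sub whole = narrow-κ v within j (λ j′≢j → ⊆A ∘ whole j′≢j ∘ A⊆)
      where
      inv : ∀ {w x h} → _≡_ {A = Name} (w , x) (core v h) → w ≡ v × ∃ λ h → x ≡ inj₂ h
      inv refl = refl , _ , refl
      within : ∀ {w x} → code (w , x) ∈ₛ A → w ≡ v × ∃ λ h → x ≡ inj₂ h
      within p = inv (code-injective (proj₂ (core⁻ {v} (sub (A⊆ p)))))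

  Good : Tree (V G) → Set
  Good t = ∀ A → (∀ {u} → u ∈ₛ A → u ∈ᵗ t) → (∀ {u} → u ∈ᵗ t → u ∈ₛ A) → κ A ≤ 3 + k × κ (∁ A) ≤ 3 + k

  columns-good : ∀ v (p : Pos (caterpillar {n = N} (columnTree v))) → Good (sub p)
  columns-good v p A A⊆ ⊆A with caterpillar-sub {n = N} (columnTree v) p
  ... | inj₁ (j , q , eq) = core-bound A⊆ ⊆A {v} j
    (λ r → column⇒core {v} {j} (inColumn r)) (λ j′≢j r → contradiction (columnOf {v} {v} {j} (inColumn r)) j′≢j)
    where
    inColumn : ∀ {u} → u ∈ᵗ sub p → u ∈ᵗ columnTree v j
    inColumn r = proj₁ (∈-sub⁻ q (subst (_ ∈ᵗ_) eq r))
  -- The suffix consists of whole columns, so any column may play the exceptional one.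
  ... | inj₂ (j , suffix⁻ , suffix⁺) = core-bound A⊆ ⊆A {v} zero
    (λ r → let j′ , _ , r′ = suffix⁻ r in column⇒core {v} {j′} r′)
    (λ {i} {x} {y} _ r → let j′ , j≤j′ , r′ = suffix⁻ r
      in suffix⁺ (subst (j ≤ᶠ_) (sym (columnOf {v} {v} {j′} r′)) j≤j′) (column⁺ {v} {i} y))

  copy-good : ∀ v (p : Pos (copyTree v)) → Good (sub p)
  copy-good v root A A⊆ ⊆A = copies-bound A⊆ ⊆A λ {w} {x} {y} r →
    subst (λ w → code (w , y) ∈ᵗ copyTree v) (sym (copyOf {v} {w} {x} r)) (copy⁺ v y)
  copy-good v (left root) A A⊆ ⊆A = apex-bound A⊆ ⊆A {v} leaf-∈⁻
  copy-good v (right root) A A⊆ ⊆A = core-bound A⊆ ⊆A {v} zero id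
    λ {j} {x} {y} _ _ → column⇒core {v} {j} (column⁺ {v} {j} y)
  copy-good v (right (left p)) A A⊆ ⊆A = core-bound A⊆ ⊆A {v} zero (λ r → left (proj₁ (∈-sub⁻ p r)))
    λ _ r → ⊥-elim (row≢column (same (proj₂ (row⁻ {v} (proj₁ (∈-sub⁻ p r)))) refl))
  copy-good v (right (right p)) = columns-good v p

  layout-good : (p : Pos layout) → Good (sub p)
  layout-good p A A⊆ ⊆A with caterpillar-sub {n = m} copyTree p
  ... | inj₁ (v , q , eq) = subst Good (sym eq) (copy-good v q) A A⊆ ⊆A
  ... | inj₂ (j , suffix⁻ , suffix⁺) = copies-bound A⊆ ⊆A λ {w} {x} {y} r →
    let v , j≤v , r′ = suffix⁻ r in suffix⁺ (subst (j ≤ᶠ_) (sym (copyOf {v} {w} {x} r′)) j≤v) (copy⁺ w y)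

  host-smw : min smw G ≤ (3 + k)
  host-smw = _ , (treeDecomposition {G} layout layout-complete layout-unique , refl) ,
    treeWidth-≤ {G} layout layout-complete layout-unique {κ} layout-good

lemma11 : (∀ (c : ℕ) → ∃ λ (G : ℕ → Graph) → ∀ (i : ℕ) →
    (min 𝓡-treewidth c (G i) ≥ i) × (min smw (G i) ≤ (c + 3)))
    ×
    (∀ (c : ℕ) → 3 ≤ c → ∃ λ (G : ℕ → Graph) → ∀ (i : ℕ) →
    (min smw (G i) ≥ i) × (min 𝓡-treewidth c (G i) ≡ 0))
lemma11 = hosts , blowups
  where
  hosts : ∀ c → ∃ λ (G : ℕ → Graph) → ∀ i → (min 𝓡-treewidth c (G i) ≥ i) × (min smw (G i) ≤ (c + 3))
  hosts c = (λ i → proj₁ (Host.host (suc c) N (suc i))) , λ i →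
    host-𝓡-treewidth ℕ.≤-refl (proj₂ (Host.host (suc c) N (suc i))) ,
    min-≤-trans (host-smw (proj₂ (Host.host (suc c) N (suc i)))) (ℕ.≤-reflexive (ℕ.+-comm 3 c))
    where
    -- With k = c + 1 rows, a third of `N` exceeds the threshold k + k(k + 1) of `Many`.
    N = 3 * suc (suc c + suc c * suc (suc c))

  blowups : ∀ c → 3 ≤ c → ∃ λ (G : ℕ → Graph) → ∀ i → (min smw (G i) ≥ i) × (min 𝓡-treewidth c (G i) ≡ 0)
  -- Bags of size 2i + 2 meet both demands of `smw-≥`: at least 2, and at least 2i for a matching of
  -- size `i`.
  blowups c 3≤c = (λ i → proj₁ (blowup (2 + (i + i)))) , λ i →
    smw-≥ (proj₂ (blowup (2 + (i + i)))) (s≤s (s≤s z≤n)) (ℕ.m≤n+m (i + i) 2) ,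
    𝓡-treewidth-zero (proj₂ (blowup (2 + (i + i)))) 3≤c
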